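{- Let $k,j\ge 0$ and $m\ge 1$ be integers and put $n=2m+kj$ (so $n\ge 1$). Then, as polynomials in the indeterminates $t_1,t_2,\dots$, $$\sum_{Q\in\mathfrak{Q}_{n,k}^{m,j}}\prod_{i\geq1}t_i^{\alpha_i(Q)}=\frac{m}{(m+j+1)(m+j)}\binom{m+j}{j}\frac{\mathbf{P}_m^{(m+j+1)}(1!\,t_1,2!\,t_2,\dots)}{m!}$$ $$=\frac{m}{(m+j+1)(m+j)}\binom{m+j}{j}\sum_{r=0}^m\binom{m+j+1}{r}\frac{r!}{m!}\,\mathbf{B}_{m,r}\big(1!\,t_1,2!\,t_2,\dots\big).$$
   Context: Fix an integer $k\ge 0$. Lattice paths use the steps $u=(1,1)$ (up-step), $d=(1,-1)$ (down-step), $h=(k,0)$ (horizontal-step), and a path is regarded as the sequence (word in the letters $u,d,h$) of its steps; for $k=0$ the letter $h$ is a formal letter not changing the position. A $k$-path of length $n$ is such a path from $(0,0)$ to $(n,0)$ that never goes below the $x$-axis. $\mathfrak{P}_{n,k}^{m,j}$ is the set of $k$-paths with exactly $m$ up-steps and $j$ horizontal-steps (hence $m$ down-steps and $n=2m+kj$). $\mathfrak{Q}_{n,k}^{m,j}$ is the subset of those $k$-paths in $\mathfrak{P}_{n,k}^{m,j}$ having no horizontal-step on the $x$-axis (i.e. at height $0$). A $u$-segment of a path is a maximal sequence of consecutive up-steps. $\alpha_i(Q)$ is the number of $u$-segments of length $i$ (i.e. with exactly $i$ up-steps) in $Q$. $\mathbf{B}_{m,r}(x_1,x_2,\dots)$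 is the partial Bell polynomial $\sum \frac{m!}{r_1!r_2!\cdots r_m!}\left(\frac{x_1}{1!}\right)^{r_1}\cdots\left(\frac{x_m}{m!}\right)^{r_m}$, the sum being over nonnegative integers with $r_1+\cdots+r_m=r$ and $r_1+2r_2+\cdots+mr_m=m$. The potential polynomials $\mathbf{P}_m^{(\lambda)}=\mathbf{P}_m^{(\lambda)}(f_1,f_2,\dots)$ are defined by $1+\sum_{m\ge1}\mathbf{P}_m^{(\lambda)}\frac{x^m}{m!}=\Big(1+\sum_{m\ge1}f_m\frac{x^m}{m!}\Big)^{\lambda}$. -}

module Defs where

open import Algebra.Bundles using (CommutativeRing)
open import Data.Fin.Base using (Fin; toℕ) renaming (zero to fzero; suc to fsuc)
open import Data.Integer.Base as ℤ using (ℤ; +_; 0ℤ; 1ℤ; -1ℤ)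
import Data.Integer.Properties as ℤₚ
open import Data.List.Base using (List; []; _∷_; _++_; map; foldr; filter; length; upTo; allFin; tabulate; cartesianProductWith)
open import Data.List.Membership.Propositional using (_∈_)
open import Data.List.Membership.Propositional.Properties
  using (∈-map⁺; ∈-filter⁺; ∈-filter⁻; ∈-cartesianProductWith⁺; ∈-upTo⁺)
open import Data.List.Properties using (map-tabulate)
open import Data.List.Relation.Unary.All using ([]; _∷_)
open import Data.List.Relation.Unary.All.Properties using () renaming (tabulate⁺ to All-tabulate⁺; map⁺ to All-map⁺)
open import Data.List.Relation.Unary.AllPairs using ([]; _∷_)
open import Data.List.Relation.Unary.Any using (here; there)
open import Data.List.Relation.Unary.Unique.Propositional using (Unique)
import Data.List.Relation.Unary.Unique.Propositional.Properties as Uniqueₚ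
open import Data.Nat.Base as ℕ using (ℕ; zero; suc; NonZero; _∸_; _!)
open import Data.Nat.ListAction using (sum; product)
open import Data.Nat.ListAction.Properties using (product≢0)
import Data.Nat.Properties as ℕₚ
open import Data.Product.Base using (_×_; _,_; proj₂)
open import Data.Rational.Base as ℚ using (ℚ; 0ℚ; 1ℚ)
import Data.Rational.Properties as ℚₚ
open import Data.Vec.Base as Vec using (Vec; []; _∷_; lookup; toList)
import Data.Vec.Properties as Vecₚ
open import Function.Bundles using (_⇔_; mk⇔)
open import Level using (0ℓ)
open import Relation.Binary.PropositionalEquality
  using (_≡_; _≢_; refl; sym; trans; cong; cong₂; subst; module ≡-Reasoning)
open import Relation.Nullary using (Dec; yes; no; ¬?; _×-dec_; _→-dec_)
open import Relation.Nullary.Decidable using (map′)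
open import Relation.Unary using (Decidable)

------------------------------------------------------------------------
-- The polynomial ring ℚ[t₀, t₁, t₂, …], presented as the free commutative
-- ℚ-algebra on the indeterminates: ring expressions modulo the congruence
-- generated by the laws of commutative ℚ-algebras.  The indeterminate t 0
-- is never used.

infixl 6 _+_
infixl 7 _*_
infix  8 -_
infix  4 _≈_

data Poly : Set where
  con     : ℚ → Poly
  t       : ℕ → Poly
  _+_ _*_ : Poly → Poly → Poly
  -_      : Poly → Poly

data _≈_ : Poly → Poly → Set where
  ≈-refl      : ∀ {p} → p ≈ p
  ≈-sym       : ∀ {p q} → p ≈ q → q ≈ p
  ≈-trans     : ∀ {p q r} → p ≈ q → q ≈ r → p ≈ r
  +-cong      : ∀ {p p′ q q′} → p ≈ p′ → q ≈ q′ → p + q ≈ p′ + q′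
  *-cong      : ∀ {p p′ q q′} → p ≈ p′ → q ≈ q′ → p * q ≈ p′ * q′
  -‿cong      : ∀ {p p′} → p ≈ p′ → - p ≈ - p′
  +-assoc     : ∀ p q r → (p + q) + r ≈ p + (q + r)
  +-comm      : ∀ p q → p + q ≈ q + p
  +-identityˡ : ∀ p → con 0ℚ + p ≈ p
  -‿inverseˡ  : ∀ p → (- p) + p ≈ con 0ℚ
  *-assoc     : ∀ p q r → (p * q) * r ≈ p * (q * r)
  *-comm      : ∀ p q → p * q ≈ q * p
  *-identityˡ : ∀ p → con 1ℚ * p ≈ p
  *-distribˡ  : ∀ p q r → p * (q + r) ≈ p * q + p * r
  con-+       : ∀ a b → con (a ℚ.+ b) ≈ con a + con b
  con-*       : ∀ a b → con (a ℚ.* b) ≈ con a * con b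

polynomialRing : CommutativeRing 0ℓ 0ℓ
polynomialRing = record
  { Carrier = Poly
  ; _≈_ = _≈_
  ; _+_ = _+_
  ; _*_ = _*_
  ; -_  = -_
  ; 0#  = con 0ℚ
  ; 1#  = con 1ℚ
  ; isCommutativeRing = record
    { isRing = record
      { +-isAbelianGroup = record
        { isGroup = record
          { isMonoid = record
            { isSemigroup = record
              { isMagma = record
                { isEquivalence = record
                  { refl = ≈-refl ; sym = ≈-sym ; trans = ≈-trans }
                ; ∙-cong = +-cong
                }
              ; assoc = +-assoc
              }
            ; identity = +-identityˡ , λ p → ≈-trans (+-comm _ _) (+-identityˡ p)
            }
          ; inverse = -‿inverseˡ , λ p → ≈-trans (+-comm _ _) (-‿inverseˡ p)
          ; ⁻¹-cong = -‿cong
          }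
        ; comm = +-comm
        }
      ; *-cong = *-cong
      ; *-assoc = *-assoc
      ; *-identity = *-identityˡ , λ p → ≈-trans (*-comm _ _) (*-identityˡ p)
      ; distrib = *-distribˡ , λ p q r →
          ≈-trans (*-comm _ _)
            (≈-trans (*-distribˡ p q r) (+-cong (*-comm _ _) (*-comm _ _)))
      }
    ; *-comm = *-comm
    }
  }

open import Algebra.Properties.Semiring.Exp (CommutativeRing.semiring polynomialRing) public
  using (_^_)

-- Evaluation at a rational point respects _≈_; in particular _≈_ is not
-- the trivial relation.

⟦_⟧ : Poly → (ℕ → ℚ) → ℚ
⟦ con a ⟧ ρ = a
⟦ t i ⟧   ρ = ρ i
⟦ p + q ⟧ ρ = ⟦ p ⟧ ρ ℚ.+ ⟦ q ⟧ ρ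
⟦ p * q ⟧ ρ = ⟦ p ⟧ ρ ℚ.* ⟦ q ⟧ ρ
⟦ - p ⟧   ρ = ℚ.- ⟦ p ⟧ ρ

⟦⟧-cong : ∀ {p q} → p ≈ q → ∀ ρ → ⟦ p ⟧ ρ ≡ ⟦ q ⟧ ρ
⟦⟧-cong ≈-refl ρ            = refl
⟦⟧-cong (≈-sym e) ρ         = sym (⟦⟧-cong e ρ)
⟦⟧-cong (≈-trans e f) ρ     = trans (⟦⟧-cong e ρ) (⟦⟧-cong f ρ)
⟦⟧-cong (+-cong e f) ρ      = cong₂ ℚ._+_ (⟦⟧-cong e ρ) (⟦⟧-cong f ρ)
⟦⟧-cong (*-cong e f) ρ      = cong₂ ℚ._*_ (⟦⟧-cong e ρ) (⟦⟧-cong f ρ)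
⟦⟧-cong (-‿cong e) ρ        = cong ℚ.-_ (⟦⟧-cong e ρ)
⟦⟧-cong (+-assoc p q r) ρ   = ℚₚ.+-assoc (⟦ p ⟧ ρ) (⟦ q ⟧ ρ) (⟦ r ⟧ ρ)
⟦⟧-cong (+-comm p q) ρ      = ℚₚ.+-comm (⟦ p ⟧ ρ) (⟦ q ⟧ ρ)
⟦⟧-cong (+-identityˡ p) ρ   = ℚₚ.+-identityˡ (⟦ p ⟧ ρ)
⟦⟧-cong (-‿inverseˡ p) ρ    = ℚₚ.+-inverseˡ (⟦ p ⟧ ρ)
⟦⟧-cong (*-assoc p q r) ρ   = ℚₚ.*-assoc (⟦ p ⟧ ρ) (⟦ q ⟧ ρ) (⟦ r ⟧ ρ)
⟦⟧-cong (*-comm p q) ρ      = ℚₚ.*-comm (⟦ p ⟧ ρ) (⟦ q ⟧ ρ)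
⟦⟧-cong (*-identityˡ p) ρ   = ℚₚ.*-identityˡ (⟦ p ⟧ ρ)
⟦⟧-cong (*-distribˡ p q r) ρ = ℚₚ.*-distribˡ-+ (⟦ p ⟧ ρ) (⟦ q ⟧ ρ) (⟦ r ⟧ ρ)
⟦⟧-cong (con-+ a b) ρ       = refl
⟦⟧-cong (con-* a b) ρ       = refl

infix 5 ∑ ∏

∑ : {A : Set} → List A → (A → Poly) → Poly
∑ xs f = foldr (λ x p → f x + p) (con 0ℚ) xs

∏ : {A : Set} → List A → (A → Poly) → Poly
∏ xs f = foldr (λ x p → f x * p) (con 1ℚ) xs

syntax ∑ xs (λ x → p) = ∑[ x ∈ xs ] p
syntax ∏ xs (λ x → p) = ∏[ x ∈ xs ] p

------------------------------------------------------------------------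
-- Lattice paths

data Step : Set where
  u d h : Step

infix 4 _≟_

_≟_ : (s s′ : Step) → Dec (s ≡ s′)
u ≟ u = yes refl
u ≟ d = no λ ()
u ≟ h = no λ ()
d ≟ u = no λ ()
d ≟ d = yes refl
d ≟ h = no λ ()
h ≟ u = no λ ()
h ≟ d = no λ ()
h ≟ h = yes refl

Word : Set
Word = List Step

-- The end point of a path starting at the origin is (abscissa k w , height w).

abscissa : ℕ → Word → ℕ
abscissa k []      = 0
abscissa k (u ∷ w) = 1 ℕ.+ abscissa k w
abscissa k (d ∷ w) = 1 ℕ.+ abscissa k w
abscissa k (h ∷ w) = k ℕ.+ abscissa k w

height : Word → ℤ
height []      = 0ℤ
height (u ∷ w) = 1ℤ ℤ.+ height w
height (d ∷ w) = -1ℤ ℤ.+ height w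
height (h ∷ w) = height w

occurrences : Step → Word → ℕ
occurrences s w = length (filter (s ≟_) w)

record IsPath (k n : ℕ) (w : Word) : Set where
  constructor isPath
  field
    abscissa-end : abscissa k w ≡ n
    height-end   : height w ≡ 0ℤ
    nonnegative  : ∀ v v′ → w ≡ v ++ v′ → 0ℤ ℤ.≤ height v

NoHorizontalOnAxis : Word → Set
NoHorizontalOnAxis w = ∀ v v′ → w ≡ v ++ h ∷ v′ → height v ≢ 0ℤ

-- Argument order: k n m j.
IsP : ℕ → ℕ → ℕ → ℕ → Word → Set
IsP k n m j w = IsPath k n w × occurrences u w ≡ m × occurrences h w ≡ j

IsQ : ℕ → ℕ → ℕ → ℕ → Word → Set
IsQ k n m j w = IsP k n m j w × NoHorizontalOnAxis w

∀split? : {P : Word → Word → Set} → (∀ v v′ → Dec (P v v′)) →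
          ∀ w → Dec (∀ v v′ → w ≡ v ++ v′ → P v v′)
∀split? {P} P? []      = map′ to (λ f → f [] [] refl) (P? [] [])
  where
  to : P [] [] → ∀ v v′ → [] ≡ v ++ v′ → P v v′
  to p [] .[] refl = p
∀split? {P} P? (s ∷ w) =
  map′ to (λ f → f [] (s ∷ w) refl , λ v v′ e → f (s ∷ v) v′ (cong (s ∷_) e))
    (P? [] (s ∷ w) ×-dec ∀split? {λ v → P (s ∷ v)} (λ v → P? (s ∷ v)) w)
  where
  to : P [] (s ∷ w) × (∀ v v′ → w ≡ v ++ v′ → P (s ∷ v) v′) →
       ∀ v v′ → s ∷ w ≡ v ++ v′ → P v v′
  to (p , f) []       .(s ∷ w) refl = p
  to (p , f) (.s ∷ v) v′       refl = f v v′ refl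

isPath? : ∀ k n → Decidable (IsPath k n)
isPath? k n w =
  map′ (λ { (a , b , c) → isPath a b c }) (λ { (isPath a b c) → a , b , c })
    ((abscissa k w ℕₚ.≟ n) ×-dec (height w ℤₚ.≟ 0ℤ)
      ×-dec ∀split? (λ v _ → 0ℤ ℤₚ.≤? height v) w)

noHorizontalOnAxis? : Decidable NoHorizontalOnAxis
noHorizontalOnAxis? w =
  map′ (λ f v v′ e → f v (h ∷ v′) e v′ refl)
       (λ { f v .(h ∷ v′) e v′ refl → f v v′ e })
       (∀split? (λ v s → dec v s) w)
  where
  dec : ∀ v s → Dec (∀ v′ → s ≡ h ∷ v′ → height v ≢ 0ℤ)
  dec v []       = yes λ _ ()
  dec v (u ∷ s)  = yes λ _ ()
  dec v (d ∷ s)  = yes λ _ ()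
  dec v (h ∷ s)  = map′ (λ z _ _ → z) (λ f → f s refl) (¬? (height v ℤₚ.≟ 0ℤ))

isQ? : ∀ k n m j → Decidable (IsQ k n m j)
isQ? k n m j w =
  (isPath? k n w ×-dec (occurrences u w ℕₚ.≟ m) ×-dec (occurrences h w ℕₚ.≟ j))
    ×-dec noHorizontalOnAxis? w

vectors : {A : Set} → List A → ∀ n → List (Vec A n)
vectors xs zero    = [] ∷ []
vectors xs (suc n) = cartesianProductWith _∷_ xs (vectors xs n)

steps : List Step
steps = u ∷ d ∷ h ∷ []

words : ℕ → List Word
words l = map toList (vectors steps l)

-- Repetition-free enumeration of the paths satisfying IsQ.  They have m
-- up-steps, m down-steps and j horizontal-steps, so it is enough to search
-- the words with 2m + j letters; see ∈-𝔔 and 𝔔-unique.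
𝔔 : (k n m j : ℕ) → List Word
𝔔 k n m j = filter (isQ? k n m j) (words (2 ℕ.* m ℕ.+ j))

record-run : ℕ → List ℕ → List ℕ
record-run zero      ls = ls
record-run c@(suc _) ls = c ∷ ls

-- uSegments c w lists the lengths of the maximal runs of up-steps of the
-- word u^c w, in order of occurrence.
uSegments : ℕ → Word → List ℕ
uSegments c []      = record-run c []
uSegments c (u ∷ w) = uSegments (suc c) w
uSegments c (d ∷ w) = record-run c (uSegments 0 w)
uSegments c (h ∷ w) = record-run c (uSegments 0 w)

α : ℕ → Word → ℕ
α i w = length (filter (i ℕₚ.≟_) (uSegments 0 w))

-- The product over all i ≥ 1 of t i ^ α i w; α i w = 0 when i exceeds the
-- number of steps of w.
weight : Word → Poly
weight w = ∏[ i ∈ map suc (upTo (length w)) ] (t i ^ α i w)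

------------------------------------------------------------------------
-- Potential polynomials

Series : Set
Series = ℕ → Poly

1ˢ : Series
1ˢ zero    = con 1ℚ
1ˢ (suc _) = con 0ℚ

_*ˢ_ : Series → Series → Series
(F *ˢ G) n = ∑[ i ∈ upTo (suc n) ] (F i * G (n ∸ i))

_^ˢ_ : Series → ℕ → Series
F ^ˢ zero  = 1ˢ
F ^ˢ suc e = F *ˢ (F ^ˢ e)

1/_! : ℕ → ℚ
1/ n ! = (1ℤ ℚ./ (n !)) {{n ℕₚ.!≢0}}

-- 1 + ∑_{n ≥ 1} f n xⁿ / n!; the value f 0 is ignored.
egf : (ℕ → Poly) → Series
egf f zero      = con 1ℚ
egf f n@(suc _) = con (1/ n !) * f n

-- The potential polynomial of order e, for a natural number e.
potential : (e m : ℕ) → (ℕ → Poly) → Poly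
potential e m f = con (+ (m !) ℚ./ 1) * (egf f ^ˢ e) m

------------------------------------------------------------------------
-- Partial Bell polynomials

-- A multi-index (r₁, …, rₘ) is a vector rs with lookup rs i = r_{toℕ i + 1}.

weightedSum : ∀ {m} → Vec ℕ m → ℕ
weightedSum {m} rs = sum (map (λ i → suc (toℕ i) ℕ.* lookup rs i) (allFin m))

IsBellIndex : (m r : ℕ) → Vec ℕ m → Set
IsBellIndex m r rs = Vec.sum rs ≡ r × weightedSum rs ≡ m

isBellIndex? : ∀ m r → Decidable (IsBellIndex m r)
isBellIndex? m r rs = (Vec.sum rs ℕₚ.≟ r) ×-dec (weightedSum rs ℕₚ.≟ m)

-- Repetition-free enumeration of the multi-indices; the weighted sum
-- forces every entry to be at most m, see ∈-bellIndices and
-- bellIndices-unique.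
bellIndices : (m r : ℕ) → List (Vec ℕ m)
bellIndices m r = filter (isBellIndex? m r) (vectors (upTo (suc m)) m)

factorials : ∀ {m} → Vec ℕ m → ℕ
factorials {m} rs = product (map (λ i → lookup rs i !) (allFin m))

factorials≢0 : ∀ {m} (rs : Vec ℕ m) → NonZero (factorials rs)
factorials≢0 {m} rs =
  product≢0 (All-map⁺ {xs = allFin m} (All-tabulate⁺ λ i → lookup rs i ℕₚ.!≢0))

bellCoefficient : ∀ m → Vec ℕ m → ℚ
bellCoefficient m rs = (+ (m !) ℚ./ factorials rs) {{factorials≢0 rs}}

B : (m r : ℕ) → (ℕ → Poly) → Poly
B m r x =
  ∑[ rs ∈ bellIndices m r ]
    (con (bellCoefficient m rs)
      * (∏[ i ∈ allFin m ]
          ((con (1/ (suc (toℕ i)) !) * x (suc (toℕ i))) ^ lookup rs i)))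

------------------------------------------------------------------------
-- The argument (1! t₁, 2! t₂, …)

i!t : ℕ → Poly
i!t i = con (+ (i !) ℚ./ 1) * t i

instance
  prefactor≢0 : ∀ {m j} .{{_ : NonZero m}} → NonZero ((m ℕ.+ j ℕ.+ 1) ℕ.* (m ℕ.+ j))
  prefactor≢0 {suc m} = _

------------------------------------------------------------------------
-- The enumerations are correct

∈-vectors : ∀ {A : Set} {xs : List A} {n} (v : Vec A n) →
            (∀ i → lookup v i ∈ xs) → v ∈ vectors xs n
∈-vectors []      f = here refl
∈-vectors (x ∷ v) f =
  ∈-cartesianProductWith⁺ _∷_ (f fzero) (∈-vectors v (λ i → f (fsuc i)))

vectors-unique : ∀ {A : Set} {xs : List A} → Unique xs → ∀ n → Unique (vectors xs n)
vectors-unique xs! zero    = [] ∷ []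
vectors-unique xs! (suc n) =
  Uniqueₚ.cartesianProductWith⁺ _∷_ Vecₚ.∷-injective xs! (vectors-unique xs! n)

∈-words : ∀ w → w ∈ words (length w)
∈-words w = subst (_∈ words (length w)) (Vecₚ.toList∘fromList w)
  (∈-map⁺ toList (∈-vectors (Vec.fromList w) (λ i → all (lookup (Vec.fromList w) i))))
  where
  all : ∀ s → s ∈ steps
  all u = here refl
  all d = there (here refl)
  all h = there (there (here refl))

height-occurrences : ∀ w → height w ℤ.+ + occurrences d w ≡ + occurrences u w
height-occurrences []      = refl
height-occurrences (u ∷ w) =
  trans (ℤₚ.+-assoc 1ℤ (height w) _) (cong (ℤ._+_ 1ℤ) (height-occurrences w))
height-occurrences (h ∷ w) = height-occurrences w
height-occurrences (d ∷ w) = begin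
  (-1ℤ ℤ.+ H) ℤ.+ (1ℤ ℤ.+ D)  ≡⟨ cong (ℤ._+ (1ℤ ℤ.+ D)) (ℤₚ.+-comm -1ℤ H) ⟩
  (H ℤ.+ -1ℤ) ℤ.+ (1ℤ ℤ.+ D)  ≡⟨ ℤₚ.+-assoc H -1ℤ (1ℤ ℤ.+ D) ⟩
  H ℤ.+ (-1ℤ ℤ.+ (1ℤ ℤ.+ D))  ≡⟨ cong (ℤ._+_ H) (sym (ℤₚ.+-assoc -1ℤ 1ℤ D)) ⟩
  H ℤ.+ (0ℤ ℤ.+ D)            ≡⟨ cong (ℤ._+_ H) (ℤₚ.+-identityˡ D) ⟩
  H ℤ.+ D                     ≡⟨ height-occurrences w ⟩
  + occurrences u w           ∎
  where
  open ≡-Reasoning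
  H D : ℤ
  H = height w
  D = + occurrences d w

length-occurrences : ∀ w →
  length w ≡ occurrences u w ℕ.+ (occurrences d w ℕ.+ occurrences h w)
length-occurrences []      = refl
length-occurrences (u ∷ w) = cong suc (length-occurrences w)
length-occurrences (d ∷ w) =
  trans (cong suc (length-occurrences w)) (sym (ℕₚ.+-suc (occurrences u w) _))
length-occurrences (h ∷ w) =
  trans (cong suc (length-occurrences w))
    (trans (sym (ℕₚ.+-suc (occurrences u w) _))
      (cong (ℕ._+_ (occurrences u w)) (sym (ℕₚ.+-suc (occurrences d w) _))))

IsQ-length : ∀ {k n m j w} → IsQ k n m j w → length w ≡ 2 ℕ.* m ℕ.+ j
IsQ-length {m = m} {j} {w} ((p , refl , refl) , _) = begin
  length w                   ≡⟨ length-occurrences w ⟩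
  U ℕ.+ (occurrences d w ℕ.+ J)
                             ≡⟨ cong (λ x → U ℕ.+ (x ℕ.+ J)) #d≡#u ⟩
  U ℕ.+ (U ℕ.+ J)            ≡⟨ sym (ℕₚ.+-assoc U U J) ⟩
  U ℕ.+ U ℕ.+ J              ≡⟨ cong (λ x → U ℕ.+ x ℕ.+ J) (sym (ℕₚ.+-identityʳ U)) ⟩
  2 ℕ.* U ℕ.+ J              ∎
  where
  open ≡-Reasoning
  U J : ℕ
  U = occurrences u w
  J = occurrences h w
  #d≡#u : occurrences d w ≡ occurrences u w
  #d≡#u = ℤₚ.+-injective (trans (sym (ℤₚ.+-identityˡ _))
    (trans (cong (λ x → x ℤ.+ + occurrences d w) (sym (IsPath.height-end p)))
      (height-occurrences w)))

∈-𝔔 : ∀ {k n m j w} → w ∈ 𝔔 k n m j ⇔ IsQ k n m j w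
∈-𝔔 {k} {n} {m} {j} {w} = mk⇔
  (λ w∈ → proj₂ (∈-filter⁻ (isQ? k n m j) {xs = words (2 ℕ.* m ℕ.+ j)} w∈))
  (λ q → ∈-filter⁺ (isQ? k n m j) (subst (λ l → w ∈ words l) (IsQ-length q) (∈-words w)) q)

𝔔-unique : ∀ k n m j → Unique (𝔔 k n m j)
𝔔-unique k n m j = Uniqueₚ.filter⁺ (isQ? k n m j)
  (Uniqueₚ.map⁺ toList-inj (vectors-unique steps! (2 ℕ.* m ℕ.+ j)))
  where
  steps! : Unique steps
  steps! = ((λ ()) ∷ (λ ()) ∷ []) ∷ ((λ ()) ∷ []) ∷ [] ∷ []

  toList-inj : ∀ {l} {v v′ : Vec Step l} → toList v ≡ toList v′ → v ≡ v′
  toList-inj {v = v} {v′} e =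
    trans (sym (Vecₚ.cast-is-id refl v)) (Vecₚ.toList-injective refl v v′ e)

lookup≤sum-tabulate : ∀ {m} (f : Fin m → ℕ) i → f i ℕ.≤ sum (tabulate f)
lookup≤sum-tabulate f fzero    = ℕₚ.m≤m+n _ _
lookup≤sum-tabulate f (fsuc i) =
  ℕₚ.≤-trans (lookup≤sum-tabulate (λ x → f (fsuc x)) i) (ℕₚ.m≤n+m _ _)

lookup≤weightedSum : ∀ {m} (rs : Vec ℕ m) i → lookup rs i ℕ.≤ weightedSum rs
lookup≤weightedSum {m} rs i = ℕₚ.≤-trans (ℕₚ.m≤n*m (lookup rs i) (suc (toℕ i)))
  (ℕₚ.≤-trans (lookup≤sum-tabulate f i)
    (ℕₚ.≤-reflexive (cong sum (sym (map-tabulate (λ x → x) f)))))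
  where
  f : Fin m → ℕ
  f x = suc (toℕ x) ℕ.* lookup rs x

∈-bellIndices : ∀ {m r rs} → rs ∈ bellIndices m r ⇔ IsBellIndex m r rs
∈-bellIndices {m} {r} {rs} = mk⇔
  (λ rs∈ → proj₂ (∈-filter⁻ (isBellIndex? m r) {xs = vectors (upTo (suc m)) m} rs∈))
  (λ q → ∈-filter⁺ (isBellIndex? m r)
    (∈-vectors rs λ i → ∈-upTo⁺ (ℕ.s≤s
      (ℕₚ.≤-trans (lookup≤weightedSum rs i) (ℕₚ.≤-reflexive (proj₂ q))))) q)

bellIndices-unique : ∀ m r → Unique (bellIndices m r)
bellIndices-unique m r =
  Uniqueₚ.filter⁺ (isBellIndex? m r) (vectors-unique (Uniqueₚ.upTo⁺ (suc m)) m)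

{-# OPTIONS --safe #-}

-- Let F = 1 + t₁ x + t₂ x² + ….  A word in 𝔔 is a non-negative path without
-- horizontal steps on the axis exactly when each of its N = m + j non-up steps
-- starts above the axis.  Cut it into its initial run of q up-steps and N blocks,
-- each a non-up step followed by a possibly empty run of up-steps: the height,
-- sampled between the blocks, goes down by at most one per block and reaches 0
-- for the first time at the end.  By the hitting time theorem (Kemperman) these
-- block sequences have total weight q/N · C(N, j) · [x^(m-q)] F^N.  Summing over q
-- gives C(N, j)/N · [x^m] (θF · F^N) with θ = x d/dx, and θF · F^N = θ(F^(N+1))/(N+1).
-- The Bell form is the binomial expansion of (1 + (F - 1))^(N+1).

module Submission where

-- The hitting time theorem is proved here, within an induction on word length. A word read letter
-- by letter may be cut inside a run of up-steps, so the induction carries the length `c` of the run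
-- under way and sums over the `a` up-steps that still extend it (`total-hitting`). Peeling off one
-- block gives a recurrence (`hitting-step`) whose factor is linear in the length `a` of the run:
-- the part free of `a` yields a coefficient of F^N, and the part in `a` one of θF · F^(N-1), which
-- the power rule for θ turns back into a coefficient of F^N. What remains is an identity between
-- binomials. The power rule applied once more, to the initial run, produces the factor m/(N(N+1)).
-- Charging F 0 = 1 for an empty run makes all blocks alike, so powers of a single series suffice.
-- On the Bell side, the multinomial coefficient of a multi-index arises as a product of binomials,
-- one for each entry, by repeatedly splitting off the constant term of the series.

open import Algebra.Bundles using (CommutativeRing; CommutativeSemiring)
import Algebra.Properties.CommutativeSemiring.Binomial as Binomial
import Algebra.Properties.Semiring.Exp as Exp
import Algebra.Properties.Semiring.Mult as Mult
import Algebra.Properties.Semiring.Sum as Sum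
open import Algebra.Structures.Biased using (isCommutativeSemiringˡ)
open import Data.Fin.Base using (Fin; toℕ) renaming (zero to fzero; suc to fsuc)
open import Data.Integer.Base as ℤ using (+_; 0ℤ; 1ℤ; -1ℤ)
import Data.Integer.Properties as ℤₚ
open import Data.List.Base
  using (List; []; _∷_; _++_; map; filter; length; applyUpTo; upTo; allFin; cartesianProductWith)
open import Data.List.Membership.Propositional using (_∈_; _∉_)
open import Data.List.Membership.Propositional.Properties using (∈-map⁺; ∈-map⁻; ∈-upTo⁺)
open import Data.List.Properties using (filter-accept; filter-reject; map-tabulate)
open import Data.List.Relation.Unary.All as All using (All; []; _∷_)
open import Data.List.Relation.Unary.All.Properties using (All¬⇒¬Any)
open import Data.List.Relation.Unary.AllPairs using ([]; _∷_)
open import Data.List.Relation.Unary.Any using (here; there)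
open import Data.List.Relation.Unary.Unique.Propositional using (Unique)
import Data.List.Relation.Unary.Unique.Propositional.Properties as Uniqueₚ
open import Data.Nat.Base as ℕ using (ℕ; zero; suc; NonZero; _∸_; _!; z<s; s<s; s≤s; z≤n)
open import Data.Nat.Combinatorics
  using (_C_; nCk+nC[k+1]≡[n+1]C[k+1]; nCk≡n!/k![n-k]!; k![n∸k]!∣n!; k>n⇒nCk≡0)
open import Data.Nat.DivMod using (m/n*n≡m)
open import Data.Nat.ListAction using (sum; product)
import Data.Nat.Properties as ℕₚ
import Data.Nat.Solver as ℕSolver
open import Data.Product.Base using (_×_; _,_; ∃-syntax)
open import Data.Rational.Base as ℚ using (ℚ; 0ℚ; 1ℚ; _/_)
import Data.Rational.Properties as ℚₚ
open import Data.Rational.Unnormalised.Base as ℚᵘ using (mkℚᵘ; *≡*)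
import Data.Rational.Unnormalised.Properties as ℚᵘₚ
open import Data.Vec.Base as Vec using (Vec; []; _∷_; lookup; toList)
open import Defs
open import Function.Base using (_∘_; id)
open import Function.Bundles using (_⇔_; mk⇔; Equivalence)
open import Relation.Binary.PropositionalEquality
  using (_≡_; _≢_; refl; sym; trans; cong; cong₂; subst)
open import Relation.Binary.Structures using (IsEquivalence)
open import Relation.Nullary using (yes; no; ¬_; contradiction)
open import Relation.Unary using (Decidable)

open CommutativeRing polynomialRing using
  ( setoid; reflexive; commutativeSemiring; +-congˡ; +-congʳ; *-congˡ; *-congʳ
  ; +-identityʳ; *-identityʳ; zeroˡ; zeroʳ)
open import Relation.Binary.Reasoning.Setoid setoid
open import Algebra.Solver.Ring.NaturalCoefficients.Default commutativeSemiring
  using (solve; _:=_; _:+_; _:*_) renaming (con to :con)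
open ℕSolver.+-*-Solver using ()
  renaming (solve to solveℕ; _:=_ to _⊜_; _:+_ to _⊕_; _:*_ to _⊗_; con to κ)

-- Finite sums

∑-cong : ∀ {A : Set} (xs : List A) {f g : A → Poly} → (∀ x → f x ≈ g x) → ∑ xs f ≈ ∑ xs g
∑-cong []       f≈g = ≈-refl
∑-cong (x ∷ xs) f≈g = +-cong (f≈g x) (∑-cong xs f≈g)

∑-++ : ∀ {A : Set} (xs ys : List A) (f : A → Poly) → ∑ (xs ++ ys) f ≈ ∑ xs f + ∑ ys f
∑-++ []       ys f = ≈-sym (+-identityˡ _)
∑-++ (x ∷ xs) ys f = ≈-trans (+-congˡ (∑-++ xs ys f)) (≈-sym (+-assoc _ _ _))

∑-map : ∀ {A B : Set} (g : A → B) xs (f : B → Poly) → ∑ (map g xs) f ≡ ∑ xs (λ x → f (g x))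
∑-map g []       f = refl
∑-map g (x ∷ xs) f = cong (λ p → f (g x) + p) (∑-map g xs f)

∑-+ : ∀ {A : Set} (xs : List A) (f g : A → Poly) → (∑[ x ∈ xs ] (f x + g x)) ≈ ∑ xs f + ∑ xs g
∑-+ []       f g = ≈-sym (+-identityˡ _)
∑-+ (x ∷ xs) f g = ≈-trans (+-congˡ (∑-+ xs f g))
  (solve 4 (λ a b c e → (a :+ b) :+ (c :+ e) := (a :+ c) :+ (b :+ e)) ≈-refl _ _ _ _)

*-distribˡ-∑ : ∀ {A : Set} (xs : List A) p (f : A → Poly) → p * ∑ xs f ≈ (∑[ x ∈ xs ] (p * f x))
*-distribˡ-∑ []       p f = zeroʳ p
*-distribˡ-∑ (x ∷ xs) p f = ≈-trans (*-distribˡ _ _ _) (+-congˡ (*-distribˡ-∑ xs p f))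

∑-zero : ∀ {A : Set} (xs : List A) {f : A → Poly} → (∀ x → f x ≈ con 0ℚ) → ∑ xs f ≈ con 0ℚ
∑-zero []       f≈0 = ≈-refl
∑-zero (x ∷ xs) f≈0 = ≈-trans (+-cong (f≈0 x) (∑-zero xs f≈0)) (+-identityˡ _)

∑-applyUpTo : ∀ {A : Set} (g : ℕ → A) n (f : A → Poly) → ∑ (applyUpTo g n) f ≡ ∑ (upTo n) (f ∘ g)
∑-applyUpTo g zero    f = refl
∑-applyUpTo g (suc n) f = cong (λ p → f (g 0) + p)
  (trans (∑-applyUpTo (g ∘ suc) n f) (sym (∑-applyUpTo suc n (f ∘ g))))

∑-upTo-suc : ∀ n (f : ℕ → Poly) → ∑ (upTo (suc n)) f ≡ f 0 + ∑ (upTo n) (f ∘ suc)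
∑-upTo-suc n f = cong (λ p → f 0 + p) (∑-applyUpTo suc n f)

∑-upTo-cong : ∀ n {f g : ℕ → Poly} → (∀ i → i ℕ.< n → f i ≈ g i) → ∑ (upTo n) f ≈ ∑ (upTo n) g
∑-upTo-cong zero            f≈g = ≈-refl
∑-upTo-cong (suc n) {f} {g} f≈g = begin
  ∑ (upTo (suc n)) f         ≡⟨ ∑-upTo-suc n f ⟩
  f 0 + ∑ (upTo n) (f ∘ suc) ≈⟨ +-cong (f≈g 0 z<s) (∑-upTo-cong n (λ i i<n → f≈g (suc i) (s<s i<n))) ⟩
  g 0 + ∑ (upTo n) (g ∘ suc) ≡⟨ ∑-upTo-suc n g ⟨
  ∑ (upTo (suc n)) g         ∎

∑-upTo-+ : ∀ m n (f : ℕ → Poly) →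
           ∑ (upTo (m ℕ.+ n)) f ≈ ∑ (upTo m) f + ∑ (upTo n) (λ i → f (m ℕ.+ i))
∑-upTo-+ zero    n f = ≈-sym (+-identityˡ _)
∑-upTo-+ (suc m) n f = begin
  ∑ (upTo (suc m ℕ.+ n)) f                                   ≡⟨ ∑-upTo-suc (m ℕ.+ n) f ⟩
  f 0 + ∑ (upTo (m ℕ.+ n)) (f ∘ suc)                         ≈⟨ +-congˡ (∑-upTo-+ m n (f ∘ suc)) ⟩
  f 0 + (∑ (upTo m) (f ∘ suc) + rest)                        ≈⟨ +-assoc _ _ _ ⟨
  f 0 + ∑ (upTo m) (f ∘ suc) + rest                          ≡⟨ cong (λ p → p + rest) (∑-upTo-suc m f) ⟨
  ∑ (upTo (suc m)) f + rest                                  ∎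
  where
  rest = ∑ (upTo n) (λ i → f (suc m ℕ.+ i))

∑-upTo-extend : ∀ m n {f : ℕ → Poly} → (∀ i → m ℕ.≤ i → f i ≈ con 0ℚ) →
                ∑ (upTo (m ℕ.+ n)) f ≈ ∑ (upTo m) f
∑-upTo-extend m n f≈0 = ≈-trans (∑-upTo-+ m n _)
  (≈-trans (+-congˡ (∑-zero (upTo n) (λ i → f≈0 (m ℕ.+ i) (ℕₚ.m≤m+n m i)))) (+-identityʳ _))

-- Rational constants

con-≡ : ∀ {a b : ℚ} → a ≡ b → con a ≈ con b
con-≡ refl = ≈-refl

toℚᵘ-/ : ∀ i n → ℚ.toℚᵘ (i ℚ./ suc n) ℚᵘ.≃ mkℚᵘ i n
toℚᵘ-/ i n = ℚₚ.toℚᵘ-fromℚᵘ (mkℚᵘ i n)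

/-homo-+ : ∀ i j → (i ℤ.+ j) ℚ./ 1 ≡ (i ℚ./ 1) ℚ.+ (j ℚ./ 1)
/-homo-+ i j = ℚₚ.toℚᵘ-injective (ℚᵘₚ.≃-trans (toℚᵘ-/ (i ℤ.+ j) 0) (ℚᵘₚ.≃-trans
  (*≡* (cong (ℤ._* 1ℤ) (sym (cong₂ ℤ._+_ (ℤₚ.*-identityʳ i) (ℤₚ.*-identityʳ j)))))
  (ℚᵘₚ.≃-sym (ℚᵘₚ.≃-trans (ℚₚ.toℚᵘ-homo-+ (i ℚ./ 1) (j ℚ./ 1))
    (ℚᵘₚ.+-cong (toℚᵘ-/ i 0) (toℚᵘ-/ j 0))))))

/-homo-* : ∀ i j m n → (i ℤ.* j) ℚ./ (suc m ℕ.* suc n) ≡ (i ℚ./ suc m) ℚ.* (j ℚ./ suc n)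
/-homo-* i j m n = ℚₚ.toℚᵘ-injective (ℚᵘₚ.≃-trans (toℚᵘ-/ (i ℤ.* j) _)
  (ℚᵘₚ.≃-sym (ℚᵘₚ.≃-trans (ℚₚ.toℚᵘ-homo-* (i ℚ./ suc m) (j ℚ./ suc n))
    (ℚᵘₚ.*-cong (toℚᵘ-/ i m) (toℚᵘ-/ j n)))))

-- Opaque to keep unification from unfolding the normalisation of rationals.
opaque
  ⌜_⌝ : ℕ → Poly
  ⌜ n ⌝ = con (+ n ℚ./ 1)

  inv : ∀ n .{{_ : NonZero n}} → Poly
  inv n = con (1ℤ ℚ./ n)

  con-/1 : ∀ n → con (+ n ℚ./ 1) ≈ ⌜ n ⌝
  con-/1 n = ≈-refl

  con-1/ : ∀ n .{{_ : NonZero n}} → con (1ℤ ℚ./ n) ≈ inv n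
  con-1/ n = ≈-refl

  ⌜0⌝ : ⌜ 0 ⌝ ≈ con 0ℚ
  ⌜0⌝ = ≈-refl

  ⌜1⌝ : ⌜ 1 ⌝ ≈ con 1ℚ
  ⌜1⌝ = ≈-refl

  inv-1 : inv 1 ≈ con 1ℚ
  inv-1 = ≈-refl

  ⌜⌝-+ : ∀ m n → ⌜ m ℕ.+ n ⌝ ≈ ⌜ m ⌝ + ⌜ n ⌝
  ⌜⌝-+ m n = ≈-trans (con-≡ (/-homo-+ (+ m) (+ n))) (con-+ _ _)

  ⌜⌝-* : ∀ m n → ⌜ m ℕ.* n ⌝ ≈ ⌜ m ⌝ * ⌜ n ⌝
  ⌜⌝-* m n = ≈-trans (con-≡ (trans (cong (ℚ._/ 1) (ℤₚ.pos-* m n)) (/-homo-* (+ m) (+ n) 0 0))) (con-* _ _)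

  ⌜⌝-inv : ∀ n .{{_ : NonZero n}} → ⌜ n ⌝ * inv n ≈ con 1ℚ
  ⌜⌝-inv (suc n) = ≈-trans (≈-sym (con-* _ _)) (con-≡
    (trans (sym (/-homo-* (+ suc n) 1ℤ 0 n)) (ℚₚ.fromℚᵘ-cong {mkℚᵘ (+ suc n ℤ.* 1ℤ) (n ℕ.+ 0)} {mkℚᵘ 1ℤ 0} (*≡* (trans (ℤₚ.*-identityʳ _)
      (trans (ℤₚ.*-identityʳ (+ suc n)) (trans (cong (λ k → + suc k) (sym (ℕₚ.+-identityʳ n))) (sym (ℤₚ.*-identityˡ _)))))))))

  con-/ : ∀ m n .{{_ : NonZero n}} → con (+ m ℚ./ n) ≈ ⌜ m ⌝ * inv n
  con-/ m (suc n) = ≈-trans (con-≡ (trans (ℚₚ./-cong (sym (ℤₚ.*-identityʳ (+ m))) (sym (ℕₚ.*-identityˡ (suc n)))) (/-homo-* (+ m) 1ℤ 0 n))) (con-* _ _)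

⌜⌝-suc : ∀ n → ⌜ suc n ⌝ ≈ con 1ℚ + ⌜ n ⌝
⌜⌝-suc n = ≈-trans (⌜⌝-+ 1 n) (+-congʳ ⌜1⌝)

-- Identities with denominators are proved below after clearing them; this removes the cleared
-- factor again.
⌜⌝-cancelˡ : ∀ n .{{_ : NonZero n}} {p q} → ⌜ n ⌝ * p ≈ ⌜ n ⌝ * q → p ≈ q
⌜⌝-cancelˡ n {p} {q} np≈nq = begin
  p                    ≈⟨ lemma p ⟨
  inv n * (⌜ n ⌝ * p)  ≈⟨ *-congˡ np≈nq ⟩
  inv n * (⌜ n ⌝ * q)  ≈⟨ lemma q ⟩
  q                    ∎
  where
  lemma : ∀ p → inv n * (⌜ n ⌝ * p) ≈ p
  lemma p = begin
    inv n * (⌜ n ⌝ * p)  ≈⟨ *-assoc _ _ _ ⟨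
    inv n * ⌜ n ⌝ * p    ≈⟨ *-congʳ (≈-trans (*-comm _ _) (⌜⌝-inv n)) ⟩
    con 1ℚ * p           ≈⟨ *-identityˡ p ⟩
    p                    ∎

-- Power series

infix 4 _≈ˢ_
_≈ˢ_ : Series → Series → Set
F ≈ˢ G = ∀ n → F n ≈ G n

0ˢ : Series
0ˢ _ = con 0ℚ

infixl 6 _+ˢ_
_+ˢ_ : Series → Series → Series
(F +ˢ G) n = F n + G n

*ˢ-cong : ∀ {F F′ G G′} → F ≈ˢ F′ → G ≈ˢ G′ → F *ˢ G ≈ˢ F′ *ˢ G′
*ˢ-cong F≈ G≈ n = ∑-cong (upTo (suc n)) (λ i → *-cong (F≈ i) (G≈ (n ∸ i)))

*ˢ-zero : ∀ F G → (F *ˢ G) 0 ≈ F 0 * G 0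
*ˢ-zero F G = +-identityʳ _

*ˢ-suc : ∀ F G n → (F *ˢ G) (suc n) ≈ F 0 * G (suc n) + ((F ∘ suc) *ˢ G) n
*ˢ-suc F G n = reflexive (∑-upTo-suc (suc n) (λ i → F i * G (suc n ∸ i)))

-- Splits off the last term of the convolution instead of the first. Set against `*ˢ-suc`, it gives
-- commutativity by induction on the coefficient, without reversing the range of summation.
*ˢ-sucʳ : ∀ F G n → (F *ˢ G) (suc n) ≈ (F *ˢ (G ∘ suc)) n + F (suc n) * G 0
*ˢ-sucʳ F G zero    = ≈-trans (*ˢ-suc F G 0) (+-cong (≈-sym (*ˢ-zero F (G ∘ suc))) (*ˢ-zero (F ∘ suc) G))
*ˢ-sucʳ F G (suc n) = begin
  (F *ˢ G) (suc (suc n))                                            ≈⟨ *ˢ-suc F G (suc n) ⟩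
  F 0 * G (2 ℕ.+ n) + ((F ∘ suc) *ˢ G) (suc n)                      ≈⟨ +-congˡ (*ˢ-sucʳ (F ∘ suc) G n) ⟩
  F 0 * G (2 ℕ.+ n) + (((F ∘ suc) *ˢ (G ∘ suc)) n + _)              ≈⟨ +-assoc _ _ _ ⟨
  F 0 * G (2 ℕ.+ n) + ((F ∘ suc) *ˢ (G ∘ suc)) n + F (2 ℕ.+ n) * G 0 ≈⟨ +-congʳ (*ˢ-suc F (G ∘ suc) n) ⟨
  (F *ˢ (G ∘ suc)) (suc n) + F (2 ℕ.+ n) * G 0                      ∎

*ˢ-comm : ∀ F G → F *ˢ G ≈ˢ G *ˢ F
*ˢ-comm F G zero    = ≈-trans (*ˢ-zero F G) (≈-trans (*-comm _ _) (≈-sym (*ˢ-zero G F)))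
*ˢ-comm F G (suc n) = begin
  (F *ˢ G) (suc n)                           ≈⟨ *ˢ-suc F G n ⟩
  F 0 * G (suc n) + ((F ∘ suc) *ˢ G) n       ≈⟨ +-cong (*-comm _ _) (*ˢ-comm (F ∘ suc) G n) ⟩
  G (suc n) * F 0 + (G *ˢ (F ∘ suc)) n       ≈⟨ +-comm _ _ ⟩
  (G *ˢ (F ∘ suc)) n + G (suc n) * F 0       ≈⟨ *ˢ-sucʳ G F n ⟨
  (G *ˢ F) (suc n)                           ∎

*ˢ-distribʳ : ∀ F G H → (G +ˢ H) *ˢ F ≈ˢ (G *ˢ F) +ˢ (H *ˢ F)
*ˢ-distribʳ F G H n = ≈-trans
  (∑-cong (upTo (suc n)) (λ i → ≈-trans (*-comm _ _) (≈-trans (*-distribˡ _ _ _) (+-cong (*-comm _ _) (*-comm _ _)))))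
  (∑-+ (upTo (suc n)) _ _)

*ˢ-scaleˡ : ∀ p F G n → ((λ i → p * F i) *ˢ G) n ≈ p * (F *ˢ G) n
*ˢ-scaleˡ p F G n = ≈-trans (∑-cong (upTo (suc n)) (λ i → *-assoc _ _ _))
  (≈-sym (*-distribˡ-∑ (upTo (suc n)) p _))

*ˢ-assoc : ∀ F G H → (F *ˢ G) *ˢ H ≈ˢ F *ˢ (G *ˢ H)
*ˢ-assoc F G H zero    = begin
  ((F *ˢ G) *ˢ H) 0    ≈⟨ *ˢ-zero (F *ˢ G) H ⟩
  (F *ˢ G) 0 * H 0     ≈⟨ *-congʳ (*ˢ-zero F G) ⟩
  F 0 * G 0 * H 0      ≈⟨ *-assoc _ _ _ ⟩
  F 0 * (G 0 * H 0)    ≈⟨ *-congˡ (*ˢ-zero G H) ⟨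
  F 0 * (G *ˢ H) 0     ≈⟨ *ˢ-zero F (G *ˢ H) ⟨
  (F *ˢ (G *ˢ H)) 0    ∎
*ˢ-assoc F G H (suc n) = begin
  ((F *ˢ G) *ˢ H) (suc n)
    ≈⟨ *ˢ-suc (F *ˢ G) H n ⟩
  (F *ˢ G) 0 * H (suc n) + (((F *ˢ G) ∘ suc) *ˢ H) n
    ≈⟨ +-cong (*-congʳ (*ˢ-zero F G)) (*ˢ-cong {G = H} (*ˢ-suc F G) (λ _ → ≈-refl) n) ⟩
  F 0 * G 0 * H (suc n) + (((λ i → F 0 * G (suc i)) +ˢ ((F ∘ suc) *ˢ G)) *ˢ H) n
    ≈⟨ +-congˡ (*ˢ-distribʳ H _ _ n) ⟩
  F 0 * G 0 * H (suc n) + (((λ i → F 0 * G (suc i)) *ˢ H) n + (((F ∘ suc) *ˢ G) *ˢ H) n)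
    ≈⟨ +-cong (*-assoc _ _ _) (+-cong (*ˢ-scaleˡ (F 0) (G ∘ suc) H n) (*ˢ-assoc (F ∘ suc) G H n)) ⟩
  F 0 * (G 0 * H (suc n)) + (F 0 * ((G ∘ suc) *ˢ H) n + ((F ∘ suc) *ˢ (G *ˢ H)) n)
    ≈⟨ +-assoc _ _ _ ⟨
  F 0 * (G 0 * H (suc n)) + F 0 * ((G ∘ suc) *ˢ H) n + ((F ∘ suc) *ˢ (G *ˢ H)) n
    ≈⟨ +-congʳ (*-distribˡ _ _ _) ⟨
  F 0 * (G 0 * H (suc n) + ((G ∘ suc) *ˢ H) n) + ((F ∘ suc) *ˢ (G *ˢ H)) n
    ≈⟨ +-congʳ (*-congˡ (*ˢ-suc G H n)) ⟨
  F 0 * (G *ˢ H) (suc n) + ((F ∘ suc) *ˢ (G *ˢ H)) n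
    ≈⟨ *ˢ-suc F (G *ˢ H) n ⟨
  (F *ˢ (G *ˢ H)) (suc n) ∎

*ˢ-zeroˡ : ∀ F → 0ˢ *ˢ F ≈ˢ 0ˢ
*ˢ-zeroˡ F n = ∑-zero (upTo (suc n)) (λ i → zeroˡ _)

*ˢ-identityˡ : ∀ F → 1ˢ *ˢ F ≈ˢ F
*ˢ-identityˡ F zero    = ≈-trans (*ˢ-zero 1ˢ F) (*-identityˡ _)
*ˢ-identityˡ F (suc n) = begin
  (1ˢ *ˢ F) (suc n)                      ≈⟨ *ˢ-suc 1ˢ F n ⟩
  con 1ℚ * F (suc n) + (0ˢ *ˢ F) n       ≈⟨ +-cong (*-identityˡ _) (*ˢ-zeroˡ F n) ⟩
  F (suc n) + con 0ℚ                     ≈⟨ +-identityʳ _ ⟩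
  F (suc n)                              ∎

*ˢ-identityʳ : ∀ F → F *ˢ 1ˢ ≈ˢ F
*ˢ-identityʳ F n = ≈-trans (*ˢ-comm F 1ˢ n) (*ˢ-identityˡ F n)

-- Makes the general binomial theorem available for series.
seriesSemiring : CommutativeSemiring _ _
seriesSemiring = record
  { Carrier = Series
  ; _≈_ = _≈ˢ_
  ; _+_ = _+ˢ_
  ; _*_ = _*ˢ_
  ; 0#  = 0ˢ
  ; 1#  = 1ˢ
  ; isCommutativeSemiring = isCommutativeSemiringˡ record
    { +-isCommutativeMonoid = record
      { isMonoid = record
        { isSemigroup = record
          { isMagma = record
            { isEquivalence = isEquivalence
            ; ∙-cong = λ e f n → +-cong (e n) (f n)
            }
          ; assoc = λ F G H n → +-assoc _ _ _
          }
        ; identity = (λ F n → +-identityˡ _) , (λ F n → +-identityʳ _)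
        }
      ; comm = λ F G n → +-comm _ _
      }
    ; *-isCommutativeMonoid = record
      { isMonoid = record
        { isSemigroup = record
          { isMagma = record { isEquivalence = isEquivalence ; ∙-cong = *ˢ-cong }
          ; assoc = *ˢ-assoc
          }
        ; identity = *ˢ-identityˡ , *ˢ-identityʳ
        }
      ; comm = *ˢ-comm
      }
    ; distribʳ = *ˢ-distribʳ
    ; zeroˡ = *ˢ-zeroˡ
    }
  }
  where
  isEquivalence : IsEquivalence _≈ˢ_
  isEquivalence = record
    { refl = λ n → ≈-refl ; sym = λ e n → ≈-sym (e n) ; trans = λ e f n → ≈-trans (e n) (f n) }

-- x d/dx
θ : Series → Series
θ F n = ⌜ n ⌝ * F n

-- In the term of index `i` the factor n is i + (n - i), one part for each of the two series. As `∸`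
-- truncates, this uses i ≤ n and hence the bounded congruence `∑-upTo-cong`.
θ-* : ∀ F G → θ (F *ˢ G) ≈ˢ (θ F *ˢ G) +ˢ (F *ˢ θ G)
θ-* F G n = begin
  ⌜ n ⌝ * (F *ˢ G) n
    ≈⟨ *-distribˡ-∑ (upTo (suc n)) _ _ ⟩
  (∑[ i ∈ upTo (suc n) ] (⌜ n ⌝ * (F i * G (n ∸ i))))
    ≈⟨ ∑-upTo-cong (suc n) term ⟩
  (∑[ i ∈ upTo (suc n) ] (⌜ i ⌝ * F i * G (n ∸ i) + F i * (⌜ n ∸ i ⌝ * G (n ∸ i))))
    ≈⟨ ∑-+ (upTo (suc n)) _ _ ⟩
  (θ F *ˢ G) n + (F *ˢ θ G) n ∎
  where
  term : ∀ i → i ℕ.< suc n → ⌜ n ⌝ * (F i * G (n ∸ i)) ≈ ⌜ i ⌝ * F i * G (n ∸ i) + F i * (⌜ n ∸ i ⌝ * G (n ∸ i))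
  term i (s≤s i≤n) = begin
    ⌜ n ⌝ * (F i * G (n ∸ i))
      ≡⟨ cong (λ k → ⌜ k ⌝ * (F i * G (n ∸ i))) (ℕₚ.m+[n∸m]≡n i≤n) ⟨
    ⌜ i ℕ.+ (n ∸ i) ⌝ * (F i * G (n ∸ i))
      ≈⟨ *-congʳ (⌜⌝-+ i (n ∸ i)) ⟩
    (⌜ i ⌝ + ⌜ n ∸ i ⌝) * (F i * G (n ∸ i))
      ≈⟨ solve 4 (λ a b f g → (a :+ b) :* (f :* g) := a :* f :* g :+ f :* (b :* g)) ≈-refl _ _ _ _ ⟩
    ⌜ i ⌝ * F i * G (n ∸ i) + F i * (⌜ n ∸ i ⌝ * G (n ∸ i)) ∎

θ-^ : ∀ F N n → θ (F ^ˢ suc N) n ≈ ⌜ suc N ⌝ * (θ F *ˢ (F ^ˢ N)) n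
θ-^ F zero    n = begin
  ⌜ n ⌝ * (F *ˢ 1ˢ) n    ≈⟨ *-congˡ (*ˢ-identityʳ F n) ⟩
  ⌜ n ⌝ * F n            ≈⟨ *ˢ-identityʳ (θ F) n ⟨
  (θ F *ˢ 1ˢ) n          ≈⟨ *-identityˡ _ ⟨
  con 1ℚ * (θ F *ˢ 1ˢ) n ≈⟨ *-congʳ ⌜1⌝ ⟨
  ⌜ 1 ⌝ * (θ F *ˢ 1ˢ) n  ∎
θ-^ F (suc N) n = begin
  θ (F ^ˢ suc (suc N)) n
    ≈⟨ θ-* F (F ^ˢ suc N) n ⟩
  (θ F *ˢ (F ^ˢ suc N)) n + (F *ˢ θ (F ^ˢ suc N)) n
    ≈⟨ +-congˡ lemma ⟩
  (θ F *ˢ (F ^ˢ suc N)) n + ⌜ suc N ⌝ * (θ F *ˢ (F ^ˢ suc N)) n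
    ≈⟨ solve 2 (λ x s → x :+ s :* x := (:con 1 :+ s) :* x) ≈-refl _ _ ⟩
  (con 1ℚ + ⌜ suc N ⌝) * (θ F *ˢ (F ^ˢ suc N)) n
    ≈⟨ *-congʳ (⌜⌝-suc (suc N)) ⟨
  ⌜ suc (suc N) ⌝ * (θ F *ˢ (F ^ˢ suc N)) n ∎
  where
  lemma : (F *ˢ θ (F ^ˢ suc N)) n ≈ ⌜ suc N ⌝ * (θ F *ˢ (F ^ˢ suc N)) n
  lemma = begin
    (F *ˢ θ (F ^ˢ suc N)) n                                  ≈⟨ *ˢ-comm F _ n ⟩
    (θ (F ^ˢ suc N) *ˢ F) n                                  ≈⟨ *ˢ-cong {G = F} (θ-^ F N) (λ _ → ≈-refl) n ⟩
    ((λ i → ⌜ suc N ⌝ * (θ F *ˢ (F ^ˢ N)) i) *ˢ F) n         ≈⟨ *ˢ-scaleˡ _ _ F n ⟩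
    ⌜ suc N ⌝ * ((θ F *ˢ (F ^ˢ N)) *ˢ F) n                   ≈⟨ *-congˡ (*ˢ-assoc (θ F) (F ^ˢ N) F n) ⟩
    ⌜ suc N ⌝ * (θ F *ˢ ((F ^ˢ N) *ˢ F)) n                   ≈⟨ *-congˡ (*ˢ-cong {F = θ F} (λ _ → ≈-refl) (*ˢ-comm (F ^ˢ N) F) n) ⟩
    ⌜ suc N ⌝ * (θ F *ˢ (F ^ˢ suc N)) n                      ∎

-- Hitting times

nCk*[k!*l!]≡n! : ∀ k l → ((k ℕ.+ l) C k) ℕ.* (k ! ℕ.* l !) ≡ (k ℕ.+ l) !
nCk*[k!*l!]≡n! k l = trans (cong₂ (λ c x → c ℕ.* (k ! ℕ.* x !)) (nCk≡n!/k![n-k]! k≤n) l≡n∸k)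
  (m/n*n≡m {{k!*[n∸k]!≢0}} (k![n∸k]!∣n! k≤n))
  where
  k≤n = ℕₚ.m≤m+n k l
  l≡n∸k = sym (ℕₚ.m+n∸m≡n k l)
  k!*[n∸k]!≢0 = k ℕₚ.!* (k ℕ.+ l ∸ k) !≢0

-- Multiplied by k! l!, both sides become (l + k + 1)!.
C-absorb : ∀ l k → suc (l ℕ.+ k) ℕ.* ((l ℕ.+ k) C k) ≡ suc l ℕ.* ((suc l ℕ.+ k) C k)
C-absorb l k = ℕₚ.*-cancelʳ-≡ _ _ (k ! ℕ.* l !) {{k ℕₚ.!* l !≢0}}
  (trans (ℕₚ.*-assoc (suc (l ℕ.+ k)) ((l ℕ.+ k) C k) (k ! ℕ.* l !))
  (trans (cong (suc (l ℕ.+ k) ℕ.*_)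
    (subst (λ n → (n C k) ℕ.* (k ! ℕ.* l !) ≡ n !) (ℕₚ.+-comm k l) (nCk*[k!*l!]≡n! k l)))
  (trans (sym (subst (λ n → (n C k) ℕ.* (k ! ℕ.* (suc l) !) ≡ n !) (ℕₚ.+-comm k (suc l)) (nCk*[k!*l!]≡n! k (suc l))))
    (solveℕ 4 (λ c a b s → c ⊗ (a ⊗ (s ⊗ b)) ⊜ s ⊗ c ⊗ (a ⊗ b)) refl ((suc l ℕ.+ k) C k) (k !) (l !) (suc l)))))

-- The words that start at height q and reach height 0 for the first time
-- after N non-up steps, j of them horizontal, each followed by a run of
-- up-steps.  By the hitting time theorem they make up the fraction q / N
-- of all such words with e up-steps.  For N = 0 only q = e = j = 0 is meaningful.
hitting : (F : Series) (N q e j : ℕ) → Poly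
hitting F zero      q e j = con 1ℚ
hitting F N@(suc _) q e j = ⌜ q ⌝ * (inv N * (⌜ N C j ⌝ * (F ^ˢ N) e))

-- One of the `j` horizontal steps has just been spent; for j = 0 there was none to spend.
hittingʰ : (F : Series) (N q e j : ℕ) → Poly
hittingʰ F N q e zero    = con 0ℚ
hittingʰ F N q e (suc j) = hitting F N q e j

-- The binomial C(n, k - 1), which must be 0 at k = 0 for Pascal's rule to hold there; truncated
-- subtraction would give 1.
C-left : ℕ → ℕ → ℕ
C-left n zero    = 0
C-left n (suc k) = n C k

C-pascal : ∀ n k → (n C k) ℕ.+ C-left n k ≡ suc n C k
C-pascal n zero    = refl
C-pascal n (suc k) = trans (ℕₚ.+-comm (n C suc k) (n C k)) (nCk+nC[k+1]≡[n+1]C[k+1] n k)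

-- Gives the horizontal case the shape of `hitting`, with `C-left` as its binomial, so that both
-- cases can be collected over `inv M`.
hittingʰ-suc : ∀ F M q e j → hittingʰ F (suc M) q e j ≈ ⌜ q ⌝ * (inv (suc M) * (⌜ C-left (suc M) j ⌝ * (F ^ˢ suc M) e))
hittingʰ-suc F M q e zero    = ≈-sym (≈-trans (*-congˡ (≈-trans (*-congˡ (≈-trans (*-congʳ ⌜0⌝) (zeroˡ _))) (zeroʳ _))) (zeroʳ _))
hittingʰ-suc F M q e (suc j) = ≈-refl

-- After adding N · C(M, j) to both sides, Pascal's rule merges the two binomials on the left into
-- C(N, j). On the right the added term equals (q + e + 1) · C(N, j) by `C-absorb`, and both sides
-- are then the same multiple of C(N, j).
hitting-coefficients : ∀ q e j → let M = q ℕ.+ e ℕ.+ j; N = suc M in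
  N ℕ.* (q ℕ.* (M C j) ℕ.+ suc q ℕ.* C-left M j) ℕ.+ e ℕ.* (N C j) ≡ M ℕ.* (suc q ℕ.* (N C j))
hitting-coefficients q e j = ℕₚ.+-cancelʳ-≡ (N ℕ.* c₁) _ _
  (trans (solveℕ 6 (λ n q a b e c → n ⊗ (q ⊗ a ⊕ (κ 1 ⊕ q) ⊗ b) ⊕ e ⊗ c ⊕ n ⊗ a
                                  ⊜ n ⊗ ((κ 1 ⊕ q) ⊗ (a ⊕ b)) ⊕ e ⊗ c) refl N q c₁ (C-left M j) e (N C j))
  (trans (cong (λ c → N ℕ.* (suc q ℕ.* c) ℕ.+ e ℕ.* (N C j)) (C-pascal M j))
  (trans (solveℕ 4 (λ m q e c → (κ 1 ⊕ m) ⊗ ((κ 1 ⊕ q) ⊗ c) ⊕ e ⊗ c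
                              ⊜ m ⊗ ((κ 1 ⊕ q) ⊗ c) ⊕ (κ 1 ⊕ (q ⊕ e)) ⊗ c) refl M q e (N C j))
    (cong (M ℕ.* (suc q ℕ.* (N C j)) ℕ.+_) (sym (C-absorb (q ℕ.+ e) j))))))
  where
  M = q ℕ.+ e ℕ.+ j
  N = suc M
  c₁ = M C j

-- Condition on the first block: its non-up step leads from height q + 1 down to q or stays level,
-- and `a` up-steps follow it.
hitting-step : ∀ F M q e j → M ≡ q ℕ.+ e ℕ.+ j →
  (∑[ a ∈ upTo (suc e) ] (F a * (hitting F M (q ℕ.+ a) (e ∸ a) j + hittingʰ F M (suc (q ℕ.+ a)) (e ∸ a) j)))
  ≈ hitting F (suc M) (suc q) e j
-- Here the value 1 of `hitting` at N = 0 enters: the only block is a down-step to the axis, and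
-- nothing follows it.
hitting-step F zero zero zero zero refl = begin
  F 0 * (con 1ℚ + con 0ℚ) + con 0ℚ     ≈⟨ +-identityʳ _ ⟩
  F 0 * (con 1ℚ + con 0ℚ)              ≈⟨ *-congˡ (+-identityʳ _) ⟩
  F 0 * con 1ℚ                         ≈⟨ *ˢ-zero F 1ˢ ⟨
  (F ^ˢ 1) 0                           ≈⟨ *-identityˡ _ ⟨
  con 1ℚ * (F ^ˢ 1) 0                  ≈⟨ *-congʳ ⌜1⌝ ⟨
  ⌜ 1 ⌝ * (F ^ˢ 1) 0                   ≈⟨ ≈-trans (*-congʳ inv-1) (*-identityˡ _) ⟨
  inv 1 * (⌜ 1 ⌝ * (F ^ˢ 1) 0)         ≈⟨ ≈-trans (*-congʳ ⌜1⌝) (*-identityˡ _) ⟨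
  hitting F 1 1 0 0                    ∎
hitting-step F M@(suc M₁) q e j M≡ = ⌜⌝-cancelˡ N (begin
  ⌜ N ⌝ * (∑[ a ∈ upTo (suc e) ] (F a * (hitting F M (q ℕ.+ a) (e ∸ a) j + hittingʰ F M (suc (q ℕ.+ a)) (e ∸ a) j)))
    ≈⟨ *-congˡ (∑-cong (upTo (suc e)) term) ⟩
  ⌜ N ⌝ * (∑[ a ∈ upTo (suc e) ] (inv M * (⌜ k ⌝ * (F a * P (e ∸ a)) + c * (θ F a * P (e ∸ a)))))
    ≈⟨ *-congˡ (*-distribˡ-∑ (upTo (suc e)) _ _) ⟨
  ⌜ N ⌝ * (inv M * (∑[ a ∈ upTo (suc e) ] (⌜ k ⌝ * (F a * P (e ∸ a)) + c * (θ F a * P (e ∸ a)))))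
    ≈⟨ *-congˡ (*-congˡ (∑-+ (upTo (suc e)) _ _)) ⟩
  ⌜ N ⌝ * (inv M * ((∑[ a ∈ upTo (suc e) ] (⌜ k ⌝ * (F a * P (e ∸ a)))) + (∑[ a ∈ upTo (suc e) ] (c * (θ F a * P (e ∸ a))))))
    ≈⟨ *-congˡ (*-congˡ (+-cong (*-distribˡ-∑ (upTo (suc e)) _ _) (*-distribˡ-∑ (upTo (suc e)) _ _))) ⟨
  ⌜ N ⌝ * (inv M * (⌜ k ⌝ * (F ^ˢ N) e + c * (θ F *ˢ P) e))
    ≈⟨ solve 6 (λ n i k y c z → n :* (i :* (k :* y :+ c :* z)) := i :* (n :* k :* y :+ c :* (n :* z))) ≈-refl _ _ _ _ _ _ ⟩
  inv M * (⌜ N ⌝ * ⌜ k ⌝ * (F ^ˢ N) e + c * (⌜ N ⌝ * (θ F *ˢ P) e))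
    -- By the power rule, N times the coefficient of θF · F^M is `e` times that of F^N; this is what
    -- the multiplication by N prepares.
    ≈⟨ *-congˡ (+-congˡ (*-congˡ (θ-^ F M e))) ⟨
  inv M * (⌜ N ⌝ * ⌜ k ⌝ * (F ^ˢ N) e + c * (⌜ e ⌝ * (F ^ˢ N) e))
    ≈⟨ *-congˡ (solve 4 (λ a y c e → a :* y :+ c :* (e :* y) := (a :+ e :* c) :* y) ≈-refl _ _ _ _) ⟩
  inv M * ((⌜ N ⌝ * ⌜ k ⌝ + ⌜ e ⌝ * c) * (F ^ˢ N) e)
    ≈⟨ *-congˡ (*-congʳ (≈-trans (⌜⌝-+ _ _) (+-cong (⌜⌝-* N k) (⌜⌝-* e _)))) ⟨
  inv M * (⌜ N ℕ.* k ℕ.+ e ℕ.* (N C j) ⌝ * (F ^ˢ N) e)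
    ≡⟨ cong (λ x → inv M * (⌜ x ⌝ * (F ^ˢ N) e)) coefficients ⟩
  inv M * (⌜ M ℕ.* (suc q ℕ.* (N C j)) ⌝ * (F ^ˢ N) e)
    ≈⟨ *-congˡ (*-congʳ (≈-trans (⌜⌝-* M _) (*-congˡ (⌜⌝-* (suc q) (N C j))))) ⟩
  inv M * (⌜ M ⌝ * (⌜ suc q ⌝ * c) * (F ^ˢ N) e)
    ≈⟨ solve 5 (λ i m q c y → i :* (m :* (q :* c) :* y) := m :* i :* (q :* (c :* y))) ≈-refl _ _ _ _ _ ⟩
  ⌜ M ⌝ * inv M * (⌜ suc q ⌝ * (c * (F ^ˢ N) e))
    ≈⟨ *-congʳ (≈-trans (⌜⌝-inv M) (≈-sym (⌜⌝-inv N))) ⟩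
  ⌜ N ⌝ * inv N * (⌜ suc q ⌝ * (c * (F ^ˢ N) e))
    ≈⟨ solve 4 (λ n i q z → n :* i :* (q :* z) := n :* (q :* (i :* z))) ≈-refl _ _ _ _ ⟩
  ⌜ N ⌝ * hitting F N (suc q) e j ∎)
  where
  N = suc M
  P = F ^ˢ M
  k = q ℕ.* (M C j) ℕ.+ suc q ℕ.* C-left M j
  c = ⌜ N C j ⌝
  coefficients : N ℕ.* k ℕ.+ e ℕ.* (N C j) ≡ M ℕ.* (suc q ℕ.* (N C j))
  coefficients = subst
    (λ M → suc M ℕ.* (q ℕ.* (M C j) ℕ.+ suc q ℕ.* C-left M j) ℕ.+ e ℕ.* (suc M C j) ≡ M ℕ.* (suc q ℕ.* (suc M C j)))
    (sym M≡) (hitting-coefficients q e j)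
  c-split : c ≈ ⌜ M C j ⌝ + ⌜ C-left M j ⌝
  c-split = ≈-trans (reflexive (cong ⌜_⌝ (sym (C-pascal M j)))) (⌜⌝-+ _ _)
  k-split : ⌜ k ⌝ ≈ ⌜ q ⌝ * ⌜ M C j ⌝ + ⌜ suc q ⌝ * ⌜ C-left M j ⌝
  k-split = ≈-trans (⌜⌝-+ _ _) (+-cong (⌜⌝-* q _) (⌜⌝-* (suc q) _))
  term : ∀ a → F a * (hitting F M (q ℕ.+ a) (e ∸ a) j + hittingʰ F M (suc (q ℕ.+ a)) (e ∸ a) j)
             ≈ inv M * (⌜ k ⌝ * (F a * P (e ∸ a)) + c * (θ F a * P (e ∸ a)))
  term a = begin
    F a * (⌜ q ℕ.+ a ⌝ * (inv M * (⌜ M C j ⌝ * P (e ∸ a))) + hittingʰ F M (suc (q ℕ.+ a)) (e ∸ a) j)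
      ≈⟨ *-congˡ (+-cong (*-congʳ (⌜⌝-+ q a)) (≈-trans (hittingʰ-suc F M₁ _ _ j) (*-congʳ (⌜⌝-+ (suc q) a)))) ⟩
    F a * ((⌜ q ⌝ + ⌜ a ⌝) * (inv M * (⌜ M C j ⌝ * P (e ∸ a))) + (⌜ suc q ⌝ + ⌜ a ⌝) * (inv M * (⌜ C-left M j ⌝ * P (e ∸ a))))
      -- Separates the part free of `a`, whose binomials form `k`, from the part linear in `a`,
      -- where a · F a is the coefficient of θF.
      ≈⟨ solve 8 (λ f p i q s a x y →
           f :* ((q :+ a) :* (i :* (x :* p)) :+ (s :+ a) :* (i :* (y :* p)))
        := i :* ((q :* x :+ s :* y) :* (f :* p) :+ (x :+ y) :* (a :* f :* p))) ≈-refl _ _ _ _ _ _ _ _ ⟩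
    inv M * ((⌜ q ⌝ * ⌜ M C j ⌝ + ⌜ suc q ⌝ * ⌜ C-left M j ⌝) * (F a * P (e ∸ a)) + (⌜ M C j ⌝ + ⌜ C-left M j ⌝) * (θ F a * P (e ∸ a)))
      ≈⟨ *-congˡ (+-cong (*-congʳ k-split) (*-congʳ c-split)) ⟨
    inv M * (⌜ k ⌝ * (F a * P (e ∸ a)) + c * (θ F a * P (e ∸ a))) ∎

-- Lattice paths

∑-cartesianProductWith : ∀ {A B C : Set} (g : A → B → C) xs ys (f : C → Poly) →
  ∑ (cartesianProductWith g xs ys) f ≈ (∑[ x ∈ xs ] (∑[ y ∈ ys ] f (g x y)))
∑-cartesianProductWith g []       ys f = ≈-refl
∑-cartesianProductWith g (x ∷ xs) ys f = ≈-trans (∑-++ (map (g x) ys) _ f)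
  (+-cong (reflexive (∑-map (g x) ys f)) (∑-cartesianProductWith g xs ys f))

∑-words : ∀ L (f : Word → Poly) → ∑ (words (suc L)) f ≈
  ∑ (words L) (f ∘ (u ∷_)) + (∑ (words L) (f ∘ (d ∷_)) + ∑ (words L) (f ∘ (h ∷_)))
∑-words L f = begin
  ∑ (words (suc L)) f
    ≡⟨ ∑-map toList (vectors steps (suc L)) f ⟩
  (∑[ v ∈ vectors steps (suc L) ] f (toList v))
    ≈⟨ ∑-cartesianProductWith _∷_ steps (vectors steps L) (f ∘ toList) ⟩
  (∑[ s ∈ steps ] (∑[ v ∈ vectors steps L ] f (s ∷ toList v)))
    ≈⟨ ∑-cong steps (λ s → reflexive (∑-map toList (vectors steps L) (f ∘ (s ∷_)))) ⟨
  (∑[ s ∈ steps ] ∑ (words L) (f ∘ (s ∷_)))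
    ≈⟨ +-congˡ (+-congˡ (+-identityʳ _)) ⟩
  ∑ (words L) (f ∘ (u ∷_)) + (∑ (words L) (f ∘ (d ∷_)) + ∑ (words L) (f ∘ (h ∷_))) ∎

module _ (F : Series) where

  -- The weight of u^c w if w leads from height p to height 0 with l down-steps
  -- and j horizontal steps, all starting above the axis, and zero otherwise.
  -- A run of c up-steps, also for c = 0, contributes F c.
  pathWeight : Word → (c p l j : ℕ) → Poly
  pathWeight []      c zero    zero    zero    = F c
  pathWeight []      c _       _       _       = con 0ℚ
  pathWeight (u ∷ w) c p       l       j       = pathWeight w (suc c) (suc p) l j
  pathWeight (d ∷ w) c (suc p) (suc l) j       = F c * pathWeight w 0 p l j
  pathWeight (d ∷ w) c _       _       _       = con 0ℚ
  pathWeight (h ∷ w) c (suc p) l       (suc j) = F c * pathWeight w 0 (suc p) l j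
  pathWeight (h ∷ w) c _       _       _       = con 0ℚ

  -- A down-step lowers `p` and `l` together, a horizontal step changes neither, and an up-step
  -- raises `p`. So l < p persists and the word cannot end at height 0.
  pathWeight-high : ∀ w c p l j → l ℕ.< p → pathWeight w c p l j ≈ con 0ℚ
  pathWeight-high []      c (suc p) l       j       l<p       = ≈-refl
  pathWeight-high (u ∷ w) c p       l       j       l<p       = pathWeight-high w (suc c) (suc p) l j (ℕₚ.m<n⇒m<1+n l<p)
  pathWeight-high (d ∷ w) c (suc p) zero    j       l<p       = ≈-refl
  pathWeight-high (d ∷ w) c (suc p) (suc l) j       (s<s l<p) = ≈-trans (*-congˡ (pathWeight-high w 0 p l j l<p)) (zeroʳ _)
  pathWeight-high (h ∷ w) c (suc p) l       zero    l<p       = ≈-refl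
  pathWeight-high (h ∷ w) c (suc p) l       (suc j) l<p       = ≈-trans (*-congˡ (pathWeight-high w 0 (suc p) l j l<p)) (zeroʳ _)

  total : (L c p l j : ℕ) → Poly
  total L c p l j = ∑[ w ∈ words L ] pathWeight w c p l j

  hitting-zero : ∀ M e j → hitting F (suc M) 0 e j ≈ con 0ℚ
  hitting-zero M e j = ≈-trans (*-congʳ ⌜0⌝) (zeroˡ _)

  -- Here `e` is the number of up-steps still to come, and `a` of them extend the run of length `c`
  -- under way. An initial up-step raises `c` and `p` and so accounts for the terms with a > 0; an
  -- initial non-up step is the term a = 0. The proof is a mutual induction on `L` with
  -- `total-nonup`.
  total-hitting : ∀ L c p e l j N → l ≡ p ℕ.+ e → N ≡ l ℕ.+ j → L ≡ e ℕ.+ N →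
    total L c p l j ≈ (∑[ a ∈ upTo (suc e) ] (F (c ℕ.+ a) * hitting F N (p ℕ.+ a) (e ∸ a) j))

  -- The first letter closes the run, so F c factors out and `hitting-step` sums up the rest. On the
  -- axis both sides vanish: no non-up step may start there, and `hitting` carries the height as a
  -- factor.
  total-nonup : ∀ L c p e l j N → l ≡ p ℕ.+ e → N ≡ l ℕ.+ j → suc L ≡ e ℕ.+ N →
    (∑[ w ∈ words L ] pathWeight (d ∷ w) c p l j) + (∑[ w ∈ words L ] pathWeight (h ∷ w) c p l j)
    ≈ F c * hitting F N p e j
  -- With N = 0 the conventional value of `hitting` would spoil the claim, but a non-up letter is
  -- present, so the equations on lengths and counts rule this case out.
  total-nonup L c zero    zero    l j       zero    l≡ N≡ ()
  total-nonup L c zero    (suc e) l j       zero    refl () L≡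
  total-nonup L c zero    e       l j       (suc M) l≡ N≡ L≡ = begin
    (∑[ w ∈ words L ] con 0ℚ) + (∑[ w ∈ words L ] con 0ℚ)  ≈⟨ +-cong (∑-zero (words L) (λ _ → ≈-refl)) (∑-zero (words L) (λ _ → ≈-refl)) ⟩
    con 0ℚ + con 0ℚ                                        ≈⟨ +-identityˡ _ ⟩
    con 0ℚ                                                 ≈⟨ zeroʳ _ ⟨
    F c * con 0ℚ                                           ≈⟨ *-congˡ (hitting-zero M e j) ⟨
    F c * hitting F (suc M) 0 e j                          ∎
  total-nonup L c (suc p) e l       j       zero    refl () L≡
  total-nonup L c (suc p) e (suc l) j       (suc M) l≡ N≡ L≡ = begin
    (∑[ w ∈ words L ] (F c * pathWeight w 0 p l j)) + (∑[ w ∈ words L ] pathWeight (h ∷ w) c (suc p) (suc l) j)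
      ≈⟨ +-cong (≈-sym (*-distribˡ-∑ (words L) _ _)) (horizontal j N≡) ⟩
    F c * total L 0 p l j + F c * (∑[ a ∈ upTo (suc e) ] (F a * hittingʰ F M (suc (p ℕ.+ a)) (e ∸ a) j))
      ≈⟨ *-distribˡ _ _ _ ⟨
    F c * (total L 0 p l j + (∑[ a ∈ upTo (suc e) ] (F a * hittingʰ F M (suc (p ℕ.+ a)) (e ∸ a) j)))
      ≈⟨ *-congˡ (+-congʳ (total-hitting L 0 p e l j M (ℕₚ.suc-injective l≡) (ℕₚ.suc-injective N≡) L≡′)) ⟩
    F c * ((∑[ a ∈ upTo (suc e) ] (F a * hitting F M (p ℕ.+ a) (e ∸ a) j)) + (∑[ a ∈ upTo (suc e) ] (F a * hittingʰ F M (suc (p ℕ.+ a)) (e ∸ a) j)))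
      ≈⟨ *-congˡ (∑-+ (upTo (suc e)) _ _) ⟨
    F c * (∑[ a ∈ upTo (suc e) ] (F a * hitting F M (p ℕ.+ a) (e ∸ a) j + F a * hittingʰ F M (suc (p ℕ.+ a)) (e ∸ a) j))
      ≈⟨ *-congˡ (∑-cong (upTo (suc e)) (λ a → *-distribˡ (F a) _ _)) ⟨
    F c * (∑[ a ∈ upTo (suc e) ] (F a * (hitting F M (p ℕ.+ a) (e ∸ a) j + hittingʰ F M (suc (p ℕ.+ a)) (e ∸ a) j)))
      ≈⟨ *-congˡ (hitting-step F M p e j (trans (ℕₚ.suc-injective N≡) (cong (ℕ._+ j) (ℕₚ.suc-injective l≡)))) ⟩
    F c * hitting F (suc M) (suc p) e j ∎
    where
    L≡′ : L ≡ e ℕ.+ M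
    L≡′ = ℕₚ.suc-injective (trans L≡ (ℕₚ.+-suc e M))
    horizontal : ∀ j → suc M ≡ suc l ℕ.+ j → (∑[ w ∈ words L ] pathWeight (h ∷ w) c (suc p) (suc l) j)
      ≈ F c * (∑[ a ∈ upTo (suc e) ] (F a * hittingʰ F M (suc (p ℕ.+ a)) (e ∸ a) j))
    horizontal zero    N≡ = begin
      (∑[ w ∈ words L ] con 0ℚ)                              ≈⟨ ∑-zero (words L) (λ _ → ≈-refl) ⟩
      con 0ℚ                                                 ≈⟨ zeroʳ _ ⟨
      F c * con 0ℚ                                           ≈⟨ *-congˡ (∑-zero (upTo (suc e)) (λ a → zeroʳ _)) ⟨
      F c * (∑[ a ∈ upTo (suc e) ] (F a * con 0ℚ))           ∎
    horizontal (suc j) N≡ = ≈-trans (≈-sym (*-distribˡ-∑ (words L) _ _))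
      (*-congˡ (total-hitting L 0 (suc p) e (suc l) j M l≡ (trans (ℕₚ.suc-injective N≡) (ℕₚ.+-suc l j)) L≡′))

  total-hitting zero    c zero zero l j zero refl refl L≡ =
    +-congʳ (≈-sym (≈-trans (*-identityʳ _) (reflexive (cong F (ℕₚ.+-identityʳ c)))))
  total-hitting zero    c (suc p) zero l j N refl refl ()
  total-hitting (suc L) c p zero l j N l≡ N≡ L≡ = begin
    total (suc L) c p l j
      ≈⟨ ∑-words L _ ⟩
    total L (suc c) (suc p) l j + _
      -- With e = 0 the height already equals `l`; one more up-step would lift it above the
      -- down-steps that are left.
      ≈⟨ +-cong (∑-zero (words L) (λ w → pathWeight-high w _ _ _ _ (ℕ.s≤s (ℕₚ.≤-reflexive (trans l≡ (ℕₚ.+-identityʳ p))))))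
                (total-nonup L c p 0 l j N l≡ N≡ L≡) ⟩
    con 0ℚ + F c * hitting F N p 0 j
      ≈⟨ +-comm _ _ ⟩
    F c * hitting F N p 0 j + con 0ℚ
      ≡⟨ cong₂ (λ c p → F c * hitting F N p 0 j + con 0ℚ) (ℕₚ.+-identityʳ c) (ℕₚ.+-identityʳ p) ⟨
    F (c ℕ.+ 0) * hitting F N (p ℕ.+ 0) 0 j + con 0ℚ ∎
  total-hitting (suc L) c p (suc e) l j N l≡ N≡ L≡ = begin
    total (suc L) c p l j
      ≈⟨ ∑-words L _ ⟩
    total L (suc c) (suc p) l j + _
      ≈⟨ +-cong (total-hitting L (suc c) (suc p) e l j N (trans l≡ (ℕₚ.+-suc p e)) N≡ (ℕₚ.suc-injective L≡))
                (total-nonup L c p (suc e) l j N l≡ N≡ L≡) ⟩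
    (∑[ a ∈ upTo (suc e) ] (F (suc c ℕ.+ a) * hitting F N (suc p ℕ.+ a) (e ∸ a) j)) + F c * hitting F N p (suc e) j
      ≈⟨ +-comm _ _ ⟩
    F c * hitting F N p (suc e) j + (∑[ a ∈ upTo (suc e) ] (F (suc c ℕ.+ a) * hitting F N (suc p ℕ.+ a) (e ∸ a) j))
      ≈⟨ +-cong (reflexive (cong₂ (λ c p → F c * hitting F N p (suc e) j) (ℕₚ.+-identityʳ c) (ℕₚ.+-identityʳ p)))
                (∑-cong (upTo (suc e)) (λ a → reflexive (cong₂ (λ c p → F c * hitting F N p (e ∸ a) j) (ℕₚ.+-suc c a) (ℕₚ.+-suc p a)))) ⟨
    F (c ℕ.+ 0) * hitting F N (p ℕ.+ 0) (suc e) j + (∑[ a ∈ upTo (suc e) ] (F (c ℕ.+ suc a) * hitting F N (p ℕ.+ suc a) (e ∸ a) j))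
      ≡⟨ ∑-upTo-suc (suc e) _ ⟨
    (∑[ a ∈ upTo (2 ℕ.+ e) ] (F (c ℕ.+ a) * hitting F N (p ℕ.+ a) (suc e ∸ a) j)) ∎

  total-closed : ∀ m j .{{_ : NonZero m}} → total (2 ℕ.* m ℕ.+ j) 0 0 m j ≈
    con (+ m ℚ./ ((m ℕ.+ j ℕ.+ 1) ℕ.* (m ℕ.+ j))) * con (+ ((m ℕ.+ j) C j) ℚ./ 1) * (F ^ˢ (m ℕ.+ j ℕ.+ 1)) m
  total-closed m@(suc _) j = ⌜⌝-cancelˡ (N′ ℕ.* N) (begin
    ⌜ N′ ℕ.* N ⌝ * total (2 ℕ.* m ℕ.+ j) 0 0 m j
      ≈⟨ *-cong ⌜N′*N⌝ (total-hitting (2 ℕ.* m ℕ.+ j) 0 0 m m j N refl refl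
           (solveℕ 2 (λ m j → κ 2 ⊗ m ⊕ j ⊜ m ⊕ (m ⊕ j)) refl m j)) ⟩
    ⌜ suc N ⌝ * ⌜ N ⌝ * (∑[ a ∈ upTo (suc m) ] (F a * (⌜ a ⌝ * (inv N * (⌜ N C j ⌝ * P (m ∸ a))))))
      ≈⟨ *-congˡ (≈-trans (∑-cong (upTo (suc m)) (λ a → rearrange _ _ _ _ _)) (≈-sym (*-distribˡ-∑ (upTo (suc m)) _ _))) ⟩
    ⌜ suc N ⌝ * ⌜ N ⌝ * (inv N * ⌜ N C j ⌝ * (θ F *ˢ P) m)
      ≈⟨ solve 5 (λ s n i c y → s :* n :* (i :* c :* y) := n :* i :* (c :* (s :* y))) ≈-refl _ _ _ _ _ ⟩
    ⌜ N ⌝ * inv N * (⌜ N C j ⌝ * (⌜ suc N ⌝ * (θ F *ˢ P) m))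
      ≈⟨ *-cong (≈-trans (⌜⌝-inv N) (≈-sym (⌜⌝-inv (N′ ℕ.* N)))) (*-congˡ (≈-sym (θ-^ F N m))) ⟩
    ⌜ N′ ℕ.* N ⌝ * inv (N′ ℕ.* N) * (⌜ N C j ⌝ * (⌜ m ⌝ * (F ^ˢ suc N) m))
      ≈⟨ solve 5 (λ s i c m y → s :* i :* (c :* (m :* y)) := s :* (m :* i :* c :* y)) ≈-refl _ _ _ _ _ ⟩
    ⌜ N′ ℕ.* N ⌝ * (⌜ m ⌝ * inv (N′ ℕ.* N) * ⌜ N C j ⌝ * (F ^ˢ suc N) m)
      ≈⟨ *-congˡ (*-cong (*-cong (con-/ m (N′ ℕ.* N)) (con-/1 (N C j))) (reflexive (cong (λ N → (F ^ˢ N) m) N′≡))) ⟨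
    ⌜ N′ ℕ.* N ⌝ * (con (+ m ℚ./ (N′ ℕ.* N)) * con (+ (N C j) ℚ./ 1) * (F ^ˢ N′) m) ∎)
    where
    N = m ℕ.+ j
    N′ = m ℕ.+ j ℕ.+ 1
    N′≡ : N′ ≡ suc N
    N′≡ = ℕₚ.+-comm N 1
    P = F ^ˢ N
    ⌜N′*N⌝ : ⌜ N′ ℕ.* N ⌝ ≈ ⌜ suc N ⌝ * ⌜ N ⌝
    ⌜N′*N⌝ = ≈-trans (⌜⌝-* N′ N) (*-congʳ (reflexive (cong ⌜_⌝ N′≡)))
    rearrange : ∀ f a i c p → f * (a * (i * (c * p))) ≈ i * c * (a * f * p)
    rearrange = solve 5 (λ f a i c p → f :* (a :* (i :* (c :* p))) := i :* c :* (a :* f :* p)) ≈-refl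

-- Trades a filtered enumeration for a sum over everything with a weight that vanishes off the
-- filter; it serves both the paths and the Bell multi-indices.
∑-filter : ∀ {A : Set} {P : A → Set} (P? : Decidable P) {f g : A → Poly} →
           (∀ x → P x → f x ≈ g x) → (∀ x → ¬ P x → g x ≈ con 0ℚ) →
           ∀ xs → ∑ (filter P? xs) f ≈ ∑ xs g
∑-filter P? f≈g g≈0 []       = ≈-refl
∑-filter P? f≈g g≈0 (x ∷ xs) with P? x
... | yes px = +-cong (f≈g x px) (∑-filter P? f≈g g≈0 xs)
... | no ¬px = ≈-trans (∑-filter P? f≈g g≈0 xs)
  (≈-trans (≈-sym (+-identityˡ _)) (+-congʳ (≈-sym (g≈0 x ¬px))))

-- Path weights as products over the lengths of `u`-segments

∏-cong : ∀ {A : Set} (xs : List A) {f g : A → Poly} → (∀ x → f x ≈ g x) → ∏ xs f ≈ ∏ xs g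
∏-cong []       f≈g = ≈-refl
∏-cong (x ∷ xs) f≈g = *-cong (f≈g x) (∏-cong xs f≈g)

∏-cong-All : ∀ {A : Set} {f g : A → Poly} {xs} → All (λ x → f x ≈ g x) xs → ∏ xs f ≈ ∏ xs g
∏-cong-All []           = ≈-refl
∏-cong-All (f≈g ∷ fs≈gs) = *-cong f≈g (∏-cong-All fs≈gs)

∏-* : ∀ {A : Set} (xs : List A) (f g : A → Poly) → (∏[ x ∈ xs ] (f x * g x)) ≈ ∏ xs f * ∏ xs g
∏-* []       f g = ≈-sym (*-identityˡ _)
∏-* (x ∷ xs) f g = ≈-trans (*-congˡ (∏-* xs f g))
  (solve 4 (λ a b c e → (a :* b) :* (c :* e) := (a :* c) :* (b :* e)) ≈-refl _ _ _ _)

∏-one : ∀ {A : Set} (xs : List A) → (∏[ x ∈ xs ] con 1ℚ) ≈ con 1ℚ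
∏-one []       = ≈-refl
∏-one (x ∷ xs) = ≈-trans (*-identityˡ _) (∏-one xs)

δ : (ℕ → Poly) → ℕ → ℕ → Poly
δ f l i with i ℕₚ.≟ l
... | yes _ = f i
... | no  _ = con 1ℚ

∏-δ-∉ : ∀ f {l xs} → l ∉ xs → ∏ xs (δ f l) ≈ con 1ℚ
∏-δ-∉ f {l} {[]}     l∉ = ≈-refl
∏-δ-∉ f {l} {x ∷ xs} l∉ with x ℕₚ.≟ l
... | yes refl = contradiction (here refl) l∉
... | no  _    = ≈-trans (*-identityˡ _) (∏-δ-∉ f (l∉ ∘ there))

∏-δ-∈ : ∀ f {l xs} → Unique xs → l ∈ xs → ∏ xs (δ f l) ≈ f l
∏-δ-∈ f {l} {x ∷ xs} (x∉ ∷ xs!) l∈ with x ℕₚ.≟ l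
... | yes refl = ≈-trans (*-congˡ (∏-δ-∉ f (All¬⇒¬Any x∉))) (*-identityʳ _)
∏-δ-∈ f {l} {x ∷ xs} (x∉ ∷ xs!) (here l≡x)  | no x≢l = contradiction (sym l≡x) x≢l
∏-δ-∈ f {l} {x ∷ xs} (x∉ ∷ xs!) (there l∈) | no x≢l = ≈-trans (*-identityˡ _) (∏-δ-∈ f xs! l∈)

count : ℕ → List ℕ → ℕ
count i ls = length (filter (i ℕₚ.≟_) ls)

^-count : ∀ f i l ls → f i ^ count i (l ∷ ls) ≈ δ f l i * f i ^ count i ls
^-count f i l ls with i ℕₚ.≟ l
... | yes i≡l = reflexive (cong (λ xs → f i ^ length xs) (filter-accept (i ℕₚ.≟_) {xs = ls} i≡l))
... | no  i≢l = ≈-trans (reflexive (cong (λ xs → f i ^ length xs) (filter-reject (i ℕₚ.≟_) {xs = ls} i≢l)))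
  (≈-sym (*-identityˡ _))

-- Induction on `ls`: a further entry `l` multiplies the i-th power by `δ f l i`, and over `xs`
-- these factors amount to a single `f l`, since `l` occurs there exactly once.
∏-^-count : ∀ f {xs ls} → Unique xs → All (_∈ xs) ls → (∏[ i ∈ xs ] (f i ^ count i ls)) ≈ ∏ ls f
∏-^-count f {xs} {[]}     xs! []         = ∏-one xs
∏-^-count f {xs} {l ∷ ls} xs! (l∈ ∷ ls⊆) = begin
  (∏[ i ∈ xs ] (f i ^ count i (l ∷ ls)))             ≈⟨ ∏-cong xs (λ i → ^-count f i l ls) ⟩
  (∏[ i ∈ xs ] (δ f l i * f i ^ count i ls))         ≈⟨ ∏-* xs _ _ ⟩
  ∏ xs (δ f l) * (∏[ i ∈ xs ] (f i ^ count i ls))    ≈⟨ *-cong (∏-δ-∈ f xs! l∈) (∏-^-count f xs! ls⊆) ⟩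
  f l * ∏ ls f                                       ∎

record-run⁺ : ∀ {P : ℕ → Set} c {ls} → (∀ {n} → suc n ≡ c → P (suc n)) → All P ls → All P (record-run c ls)
record-run⁺ zero    pc ps = ps
record-run⁺ (suc c) pc ps = pc refl ∷ ps

-- Shows that the finite range in `weight` misses no segment. It also excludes length 0, the one
-- index at which `egf i!t` and `t` differ.
uSegments-∈ : ∀ L c w → c ℕ.+ length w ℕ.≤ L → All (_∈ map suc (upTo L)) (uSegments c w)
uSegments-∈ L c w c+w≤L = go c w c+w≤L
  where
  run : ∀ {c k} → c ℕ.+ k ℕ.≤ L → ∀ {n} → suc n ≡ c → suc n ∈ map suc (upTo L)
  run c+k≤L refl = ∈-map⁺ suc (∈-upTo⁺ (ℕₚ.≤-trans (ℕₚ.m≤m+n _ _) c+k≤L))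
  drop : ∀ {c k} → c ℕ.+ suc k ℕ.≤ L → k ℕ.≤ L
  drop {c} {k} le = ℕₚ.≤-trans (ℕₚ.≤-trans (ℕₚ.n≤1+n k) (ℕₚ.m≤n+m (suc k) c)) le
  go : ∀ c w → c ℕ.+ length w ℕ.≤ L → All (_∈ map suc (upTo L)) (uSegments c w)
  go c []      le = record-run⁺ c (run le) []
  go c (u ∷ w) le = go (suc c) w (subst (ℕ._≤ L) (ℕₚ.+-suc c (length w)) le)
  go c (d ∷ w) le = record-run⁺ c (run le) (go 0 w (drop {c} le))
  go c (h ∷ w) le = record-run⁺ c (run le) (go 0 w (drop {c} le))

weight-uSegments : ∀ w → weight w ≈ ∏ (uSegments 0 w) t
weight-uSegments w = ∏-^-count t (Uniqueₚ.map⁺ ℕₚ.suc-injective (Uniqueₚ.upTo⁺ (length w)))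
  (uSegments-∈ (length w) 0 w ℕₚ.≤-refl)

-- Admissible paths as inductively generated descents

data Descent : (p l j : ℕ) → Word → Set where
  end  : Descent 0 0 0 []
  up   : ∀ {p l j w} → Descent (suc p) l j w → Descent p l j (u ∷ w)
  down : ∀ {p l j w} → Descent p l j w → Descent (suc p) (suc l) j (d ∷ w)
  flat : ∀ {p l j w} → Descent (suc p) l j w → Descent (suc p) l (suc j) (h ∷ w)

-- `pathWeight` charges every block, whereas `uSegments` skips empty runs; F 0 = 1 reconciles the
-- two.
∏-record-run : ∀ {F : Series} → F 0 ≈ con 1ℚ → ∀ c ls → ∏ (record-run c ls) F ≈ F c * ∏ ls F
∏-record-run F0≈1 zero    ls = ≈-sym (≈-trans (*-congʳ F0≈1) (*-identityˡ _))
∏-record-run F0≈1 (suc c) ls = ≈-refl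

pathWeight-Descent : ∀ {F : Series} → F 0 ≈ con 1ℚ → ∀ {p l j w} → Descent p l j w → ∀ c →
                     pathWeight F w c p l j ≈ ∏ (uSegments c w) F
pathWeight-Descent F0≈1 end      c = ≈-sym (≈-trans (∏-record-run F0≈1 c []) (*-identityʳ _))
pathWeight-Descent F0≈1 (up s)   c = pathWeight-Descent F0≈1 s (suc c)
pathWeight-Descent F0≈1 (down s) c = ≈-trans (*-congˡ (pathWeight-Descent F0≈1 s 0)) (≈-sym (∏-record-run F0≈1 c _))
pathWeight-Descent F0≈1 (flat s) c = ≈-trans (*-congˡ (pathWeight-Descent F0≈1 s 0)) (≈-sym (∏-record-run F0≈1 c _))

pathWeight-¬Descent : ∀ F w c p l j → ¬ Descent p l j w → pathWeight F w c p l j ≈ con 0ℚ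
pathWeight-¬Descent F []      c zero    zero    zero    ¬s = contradiction end ¬s
pathWeight-¬Descent F []      c zero    zero    (suc j) ¬s = ≈-refl
pathWeight-¬Descent F []      c zero    (suc l) j       ¬s = ≈-refl
pathWeight-¬Descent F []      c (suc p) l       j       ¬s = ≈-refl
pathWeight-¬Descent F (u ∷ w) c p       l       j       ¬s = pathWeight-¬Descent F w (suc c) (suc p) l j (¬s ∘ up)
pathWeight-¬Descent F (d ∷ w) c zero    l       j       ¬s = ≈-refl
pathWeight-¬Descent F (d ∷ w) c (suc p) zero    j       ¬s = ≈-refl
pathWeight-¬Descent F (d ∷ w) c (suc p) (suc l) j       ¬s =
  ≈-trans (*-congˡ (pathWeight-¬Descent F w 0 p l j (¬s ∘ down))) (zeroʳ _)
pathWeight-¬Descent F (h ∷ w) c zero    l       j       ¬s = ≈-refl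
pathWeight-¬Descent F (h ∷ w) c (suc p) l       zero    ¬s = ≈-refl
pathWeight-¬Descent F (h ∷ w) c (suc p) l       (suc j) ¬s =
  ≈-trans (*-congˡ (pathWeight-¬Descent F w 0 (suc p) l j (¬s ∘ flat))) (zeroʳ _)

up-shift : ∀ p i → + suc p ℤ.+ i ≡ + p ℤ.+ (1ℤ ℤ.+ i)
up-shift p i = trans (cong (λ q → + q ℤ.+ i) (ℕₚ.+-comm 1 p)) (ℤₚ.+-assoc (+ p) 1ℤ i)

down-shift : ∀ p i → + p ℤ.+ i ≡ + suc p ℤ.+ (-1ℤ ℤ.+ i)
down-shift p i = ℤₚ.+-assoc (+ suc p) -1ℤ i

-- The conditions of IsQ on the part w of a path that starts at height p.
record Remainder (p : ℕ) (w : Word) : Set where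
  constructor remainder
  field
    height-end  : + p ℤ.+ height w ≡ 0ℤ
    nonnegative : ∀ v v′ → w ≡ v ++ v′ → 0ℤ ℤ.≤ + p ℤ.+ height v
    noAxis      : ∀ v v′ → w ≡ v ++ h ∷ v′ → + p ℤ.+ height v ≢ 0ℤ

-- The forbidden letters at height 0 are refuted by the shortest prefixes: a down-step by the prefix
-- that consists of it, a horizontal step by the empty prefix before it.
Remainder⇒Descent : ∀ w p → Remainder p w → Descent p (occurrences d w) (occurrences h w) w
Remainder⇒Descent []      zero    _ = end
Remainder⇒Descent []      (suc p) r with () ← Remainder.height-end r
Remainder⇒Descent (u ∷ w) p       (remainder e n a) = up (Remainder⇒Descent w (suc p) (remainder
  (trans (up-shift p (height w)) e)
  (λ v v′ eq → subst (0ℤ ℤ.≤_) (sym (up-shift p (height v))) (n (u ∷ v) v′ (cong (u ∷_) eq)))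
  (λ v v′ eq → a (u ∷ v) v′ (cong (u ∷_) eq) ∘ trans (sym (up-shift p (height v))))))
Remainder⇒Descent (d ∷ w) zero    (remainder e n a) with () ← n (d ∷ []) w refl
Remainder⇒Descent (d ∷ w) (suc p) (remainder e n a) = down (Remainder⇒Descent w p (remainder
  (trans (down-shift p (height w)) e)
  (λ v v′ eq → subst (0ℤ ℤ.≤_) (sym (down-shift p (height v))) (n (d ∷ v) v′ (cong (d ∷_) eq)))
  (λ v v′ eq → a (d ∷ v) v′ (cong (d ∷_) eq) ∘ trans (sym (down-shift p (height v))))))
Remainder⇒Descent (h ∷ w) zero    (remainder e n a) = contradiction refl (a [] w refl)
Remainder⇒Descent (h ∷ w) (suc p) (remainder e n a) = flat (Remainder⇒Descent w (suc p) (remainder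
  e
  (λ v v′ eq → n (h ∷ v) v′ (cong (h ∷_) eq))
  (λ v v′ eq → a (h ∷ v) v′ (cong (h ∷_) eq))))

Descent⇒Remainder : ∀ {p l j w} → Descent p l j w → Remainder p w
Descent⇒Remainder end = remainder refl (λ { [] _ _ → ℤₚ.≤-refl }) (λ { [] _ () ; (_ ∷ _) _ () })
Descent⇒Remainder {p} (up {w = w} s) with remainder e n a ← Descent⇒Remainder s = remainder
  (trans (sym (up-shift p (height w))) e)
  (λ { [] v′ eq → ℤ.+≤+ ℕ.z≤n
     ; (.u ∷ v) v′ refl → subst (0ℤ ℤ.≤_) (up-shift p (height v)) (n v v′ refl) })
  (λ { [] v′ ()
     ; (.u ∷ v) v′ refl → a v v′ refl ∘ trans (up-shift p (height v)) })
Descent⇒Remainder {suc p} (down {w = w} s) with remainder e n a ← Descent⇒Remainder s = remainder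
  (trans (sym (down-shift p (height w))) e)
  (λ { [] v′ eq → ℤ.+≤+ ℕ.z≤n
     ; (.d ∷ v) v′ refl → subst (0ℤ ℤ.≤_) (down-shift p (height v)) (n v v′ refl) })
  (λ { [] v′ ()
     ; (.d ∷ v) v′ refl → a v v′ refl ∘ trans (down-shift p (height v)) })
Descent⇒Remainder {suc p} (flat s) with remainder e n a ← Descent⇒Remainder s = remainder
  e
  (λ { [] v′ eq → ℤ.+≤+ ℕ.z≤n
     ; (.h ∷ v) v′ refl → n v v′ refl })
  (λ { [] v′ eq ()
     ; (.h ∷ v) v′ refl → a v v′ refl })

Descent-occurrences : ∀ {p l j w} → Descent p l j w →
  p ℕ.+ occurrences u w ≡ l × occurrences d w ≡ l × occurrences h w ≡ j
Descent-occurrences end = refl , refl , refl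
Descent-occurrences {p} (up s) with U , D , H ← Descent-occurrences s = trans (ℕₚ.+-suc p _) U , D , H
Descent-occurrences (down s) with U , D , H ← Descent-occurrences s = cong suc U , cong suc D , H
Descent-occurrences (flat s) with U , D , H ← Descent-occurrences s = U , D , cong suc H

abscissa-occurrences : ∀ k w → abscissa k w ≡ occurrences u w ℕ.+ occurrences d w ℕ.+ k ℕ.* occurrences h w
abscissa-occurrences k []      = sym (ℕₚ.*-zeroʳ k)
abscissa-occurrences k (u ∷ w) = cong suc (abscissa-occurrences k w)
abscissa-occurrences k (d ∷ w) = trans (cong suc (abscissa-occurrences k w))
  (cong (ℕ._+ k ℕ.* occurrences h w) (sym (ℕₚ.+-suc (occurrences u w) (occurrences d w))))
abscissa-occurrences k (h ∷ w) = trans (cong (k ℕ.+_) (abscissa-occurrences k w))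
  (solveℕ 3 (λ k x y → k ⊕ (x ⊕ k ⊗ y) ⊜ x ⊕ k ⊗ (κ 1 ⊕ y)) refl k (occurrences u w ℕ.+ occurrences d w) (occurrences h w))

-- `IsQ` prescribes the number of up-steps, `Descent` that of down-steps; the final height 0 makes
-- them equal, and the letter counts determine the abscissa.
IsQ⇔Descent : ∀ k m j w → IsQ k (2 ℕ.* m ℕ.+ k ℕ.* j) m j w ⇔ Descent 0 m j w
IsQ⇔Descent k m j w = mk⇔ to from
  where
  to : IsQ k (2 ℕ.* m ℕ.+ k ℕ.* j) m j w → Descent 0 m j w
  to ((isPath _ e n , refl , refl) , a) = subst (λ l → Descent 0 l (occurrences h w) w) #d≡#u
    (Remainder⇒Descent w 0 (remainder (trans (ℤₚ.+-identityˡ _) e)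
      (λ v v′ eq → subst (0ℤ ℤ.≤_) (sym (ℤₚ.+-identityˡ _)) (n v v′ eq))
      (λ v v′ eq → a v v′ eq ∘ trans (sym (ℤₚ.+-identityˡ _)))))
    where
    #d≡#u : occurrences d w ≡ occurrences u w
    #d≡#u = ℤₚ.+-injective (trans (sym (ℤₚ.+-identityˡ _))
      (trans (cong (λ x → x ℤ.+ + occurrences d w) (sym e)) (height-occurrences w)))
  from : Descent 0 m j w → IsQ k (2 ℕ.* m ℕ.+ k ℕ.* j) m j w
  from s with remainder e n a ← Descent⇒Remainder s | U , D , H ← Descent-occurrences s =
    (isPath
      (trans (abscissa-occurrences k w) (trans (cong₂ ℕ._+_ (cong₂ ℕ._+_ U D) (cong (k ℕ.*_) H))
        (cong (λ x → m ℕ.+ x ℕ.+ k ℕ.* j) (sym (ℕₚ.+-identityʳ m)))))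
      (trans (sym (ℤₚ.+-identityˡ _)) e)
      (λ v v′ eq → subst (0ℤ ℤ.≤_) (ℤₚ.+-identityˡ _) (n v v′ eq))
    , U , H)
    , λ v v′ eq → a v v′ eq ∘ trans (ℤₚ.+-identityˡ _)

-- Specialisation of the series to `egf i!t`

1/!-! : ∀ n → con (1/ n !) * con (+ (n !) ℚ./ 1) ≈ con 1ℚ
1/!-! n = ≈-trans (*-cong (con-1/ (n !) {{n ℕₚ.!≢0}}) (con-/1 (n !)))
  (≈-trans (*-comm _ _) (⌜⌝-inv (n !) {{n ℕₚ.!≢0}}))

egf-i!t : ∀ n → egf i!t (suc n) ≈ t (suc n)
egf-i!t n = ≈-trans (≈-sym (*-assoc _ _ _)) (≈-trans (*-congʳ (1/!-! (suc n))) (*-identityˡ _))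

∏-uSegments-egf : ∀ w → ∏ (uSegments 0 w) (egf i!t) ≈ ∏ (uSegments 0 w) t
∏-uSegments-egf w = ∏-cong-All (All.map (λ l∈ → lemma (∈-map⁻ suc l∈)) (uSegments-∈ (length w) 0 w ℕₚ.≤-refl))
  where
  lemma : ∀ {l} → ∃[ n ] (n ∈ upTo (length w) × l ≡ suc n) → egf i!t l ≈ t l
  lemma (n , _ , refl) = egf-i!t n

∑-𝔔 : ∀ k j m → ∑ (𝔔 k (2 ℕ.* m ℕ.+ k ℕ.* j) m j) weight ≈ total (egf i!t) (2 ℕ.* m ℕ.+ j) 0 0 m j
∑-𝔔 k j m = ∑-filter (isQ? k (2 ℕ.* m ℕ.+ k ℕ.* j) m j)
  (λ w q → ≈-trans (weight-uSegments w) (≈-trans (≈-sym (∏-uSegments-egf w))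
    (≈-sym (pathWeight-Descent ≈-refl (Equivalence.to (IsQ⇔Descent k m j w) q) 0))))
  (λ w ¬q → pathWeight-¬Descent (egf i!t) w 0 0 m j (¬q ∘ Equivalence.from (IsQ⇔Descent k m j w)))
  (words (2 ℕ.* m ℕ.+ j))

-- Powers of series as Bell polynomials

module Seriesₛ = CommutativeSemiring seriesSemiring
open Exp Seriesₛ.semiring using () renaming (_^_ to _^ₛ_)
open Mult Seriesₛ.semiring using () renaming (_×_ to _×ₛ_)
open Sum Seriesₛ.semiring using () renaming (sum to sumₛ)

^ₛ≡^ˢ : ∀ F n → F ^ₛ n ≡ F ^ˢ n
^ₛ≡^ˢ F zero    = refl
^ₛ≡^ˢ F (suc n) = cong (F *ˢ_) (^ₛ≡^ˢ F n)

^ˢ-cong : ∀ {F G} → F ≈ˢ G → ∀ e → F ^ˢ e ≈ˢ G ^ˢ e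
^ˢ-cong F≈G zero    n = ≈-refl
^ˢ-cong F≈G (suc e)   = *ˢ-cong F≈G (^ˢ-cong F≈G e)

×ₛ-coefficient : ∀ k F n → (k ×ₛ F) n ≈ ⌜ k ⌝ * F n
×ₛ-coefficient zero    F n = ≈-sym (≈-trans (*-congʳ ⌜0⌝) (zeroˡ _))
×ₛ-coefficient (suc k) F n = begin
  F n + (k ×ₛ F) n         ≈⟨ +-congˡ (×ₛ-coefficient k F n) ⟩
  F n + ⌜ k ⌝ * F n        ≈⟨ solve 2 (λ x k → x :+ k :* x := (:con 1 :+ k) :* x) ≈-refl _ _ ⟩
  (con 1ℚ + ⌜ k ⌝) * F n   ≈⟨ *-congʳ (⌜⌝-suc k) ⟨
  ⌜ suc k ⌝ * F n          ∎

sumₛ-coefficient : ∀ k (H : ℕ → Series) n → sumₛ {k} (λ i → H (toℕ i)) n ≈ (∑[ i ∈ upTo k ] H i n)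
sumₛ-coefficient zero    H n = ≈-refl
sumₛ-coefficient (suc k) H n = ≈-trans (+-congˡ (sumₛ-coefficient k (H ∘ suc) n))
  (reflexive (sym (∑-upTo-suc k (λ i → H i n))))

binomialˢ : ∀ e F G n → ((F +ˢ G) ^ˢ e) n ≈
            (∑[ r ∈ upTo (suc e) ] (⌜ e C r ⌝ * ((F ^ˢ r) *ˢ (G ^ˢ (e ∸ r))) n))
binomialˢ e F G n = begin
  ((F +ˢ G) ^ˢ e) n
    ≡⟨ cong (λ H → H n) (^ₛ≡^ˢ (F +ˢ G) e) ⟨
  ((F +ˢ G) ^ₛ e) n
    ≈⟨ Binomial.theorem seriesSemiring e F G n ⟩
  sumₛ {suc e} (λ i → (e C toℕ i) ×ₛ ((F ^ₛ toℕ i) *ˢ (G ^ₛ (e ∸ toℕ i)))) n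
    ≈⟨ sumₛ-coefficient (suc e) (λ r → (e C r) ×ₛ ((F ^ₛ r) *ˢ (G ^ₛ (e ∸ r)))) n ⟩
  (∑[ r ∈ upTo (suc e) ] ((e C r) ×ₛ ((F ^ₛ r) *ˢ (G ^ₛ (e ∸ r)))) n)
    ≈⟨ ∑-cong (upTo (suc e)) (λ r → ≈-trans (×ₛ-coefficient (e C r) _ n)
         (*-congˡ (reflexive (cong₂ (λ F G → (F *ˢ G) n) (^ₛ≡^ˢ F r) (^ₛ≡^ˢ G (e ∸ r)))))) ⟩
  (∑[ r ∈ upTo (suc e) ] (⌜ e C r ⌝ * ((F ^ˢ r) *ˢ (G ^ˢ (e ∸ r))) n)) ∎

1ˢ-^ : ∀ e → 1ˢ ^ˢ e ≈ˢ 1ˢ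
1ˢ-^ zero    n = ≈-refl
1ˢ-^ (suc e) n = ≈-trans (*ˢ-identityˡ (1ˢ ^ˢ e) n) (1ˢ-^ e n)

constant : Poly → Series
constant p zero    = p
constant p (suc n) = con 0ℚ

constant-* : ∀ p F n → (constant p *ˢ F) n ≈ p * F n
constant-* p F zero    = *ˢ-zero (constant p) F
constant-* p F (suc n) = ≈-trans (*ˢ-suc (constant p) F n)
  (≈-trans (+-congˡ (*ˢ-zeroˡ F n)) (+-identityʳ _))

constant-^ : ∀ p c F n → ((constant p ^ˢ c) *ˢ F) n ≈ p ^ c * F n
constant-^ p zero    F n = ≈-trans (*ˢ-identityˡ F n) (≈-sym (*-identityˡ _))
constant-^ p (suc c) F n = begin
  ((constant p ^ˢ suc c) *ˢ F) n             ≈⟨ *ˢ-assoc (constant p) (constant p ^ˢ c) F n ⟩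
  (constant p *ˢ ((constant p ^ˢ c) *ˢ F)) n ≈⟨ constant-* p ((constant p ^ˢ c) *ˢ F) n ⟩
  p * ((constant p ^ˢ c) *ˢ F) n             ≈⟨ *-congˡ (constant-^ p c F n) ⟩
  p * (p ^ c * F n)                          ≈⟨ *-assoc _ _ _ ⟨
  p ^ suc c * F n                            ∎

infixr 9 x·_
x·_ : Series → Series
(x· F) zero    = con 0ℚ
(x· F) (suc n) = F n

x·-* : ∀ F G → (x· F) *ˢ G ≈ˢ x· (F *ˢ G)
x·-* F G zero    = ≈-trans (*ˢ-zero (x· F) G) (zeroˡ _)
x·-* F G (suc n) = ≈-trans (*ˢ-suc (x· F) G n) (≈-trans (+-congʳ (zeroˡ _)) (+-identityˡ _))

x·-^-< : ∀ F r n → n ℕ.< r → ((x· F) ^ˢ r) n ≈ con 0ℚ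
x·-^-< F (suc r) zero    n<r       = x·-* F ((x· F) ^ˢ r) 0
x·-^-< F (suc r) (suc n) (s<s n<r) = ≈-trans (x·-* F ((x· F) ^ˢ r) (suc n)) (vanish n n<r)
  where
  vanish : ∀ n → n ℕ.< r → (F *ˢ ((x· F) ^ˢ r)) n ≈ con 0ℚ
  vanish n n<r = ∑-zero (upTo (suc n)) (λ i → ≈-trans
    (*-congˡ (x·-^-< F r (n ∸ i) (ℕₚ.≤-<-trans (ℕₚ.m∸n≤m n i) n<r))) (zeroʳ _))

-- The zero coefficients of `G` kill the last r terms of the convolution; each use of `*ˢ-sucʳ`
-- drops one of them.
*ˢ-shift : ∀ F G r → (∀ n → n ℕ.< r → G n ≈ con 0ℚ) → ∀ m → (F *ˢ G) (r ℕ.+ m) ≈ (F *ˢ (λ n → G (r ℕ.+ n))) m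
*ˢ-shift F G zero    G≈0 m = ≈-refl
*ˢ-shift F G (suc r) G≈0 m = begin
  (F *ˢ G) (suc (r ℕ.+ m))
    ≈⟨ *ˢ-sucʳ F G (r ℕ.+ m) ⟩
  (F *ˢ (G ∘ suc)) (r ℕ.+ m) + F (suc (r ℕ.+ m)) * G 0
    ≈⟨ +-cong (*ˢ-shift F (G ∘ suc) r (λ n n<r → G≈0 (suc n) (s<s n<r)) m) (≈-trans (*-congˡ (G≈0 0 z<s)) (zeroʳ _)) ⟩
  (F *ˢ (λ n → G (suc r ℕ.+ n))) m + con 0ℚ
    ≈⟨ +-identityʳ _ ⟩
  (F *ˢ (λ n → G (suc r ℕ.+ n))) m ∎

x·-^-+ : ∀ F r m → ((x· F) ^ˢ r) (r ℕ.+ m) ≈ (F ^ˢ r) m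
x·-^-+ F zero    m = ≈-refl
x·-^-+ F (suc r) m = begin
  ((x· F) ^ˢ suc r) (suc r ℕ.+ m)                  ≈⟨ x·-* F ((x· F) ^ˢ r) (suc r ℕ.+ m) ⟩
  (F *ˢ ((x· F) ^ˢ r)) (r ℕ.+ m)                   ≈⟨ *ˢ-shift F ((x· F) ^ˢ r) r (x·-^-< F r) m ⟩
  (F *ˢ (λ n → ((x· F) ^ˢ r) (r ℕ.+ n))) m         ≈⟨ *ˢ-cong {F} (λ _ → ≈-refl) (x·-^-+ F r) m ⟩
  (F ^ˢ suc r) m                                   ∎

-- Each of the r factors gives up one x, which lowers the exponent by r. The rest is the binomial
-- expansion of F = F 0 + x· (F ∘ suc); `c`, the number of factors that contribute F 0, is the first
-- entry of the multi-index.
x·-^-recurrence : ∀ F r m → ((x· F) ^ˢ r) (r ℕ.+ m) ≈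
  (∑[ c ∈ upTo (suc r) ] (⌜ r C c ⌝ * (F 0 ^ c * ((x· (F ∘ suc)) ^ˢ (r ∸ c)) m)))
x·-^-recurrence F r m = begin
  ((x· F) ^ˢ r) (r ℕ.+ m)
    ≈⟨ x·-^-+ F r m ⟩
  (F ^ˢ r) m
    ≈⟨ ^ˢ-cong split r m ⟩
  ((constant (F 0) +ˢ (x· (F ∘ suc))) ^ˢ r) m
    ≈⟨ binomialˢ r (constant (F 0)) (x· (F ∘ suc)) m ⟩
  (∑[ c ∈ upTo (suc r) ] (⌜ r C c ⌝ * ((constant (F 0) ^ˢ c) *ˢ ((x· (F ∘ suc)) ^ˢ (r ∸ c))) m))
    ≈⟨ ∑-cong (upTo (suc r)) (λ c → *-congˡ (constant-^ (F 0) c ((x· (F ∘ suc)) ^ˢ (r ∸ c)) m)) ⟩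
  (∑[ c ∈ upTo (suc r) ] (⌜ r C c ⌝ * (F 0 ^ c * ((x· (F ∘ suc)) ^ˢ (r ∸ c)) m))) ∎
  where
  split : F ≈ˢ constant (F 0) +ˢ (x· (F ∘ suc))
  split zero    = ≈-sym (+-identityʳ _)
  split (suc n) = ≈-sym (+-identityˡ _)

-- The contribution of the multi-index rs to the coefficient of x^m in (x· F)^r;
-- it vanishes unless the entries of rs have sum r and weighted sum m.
multinomialTerm : ∀ {l} → Series → Vec ℕ l → (r m : ℕ) → Poly
multinomialTerm F []       zero zero = con 1ℚ
multinomialTerm F []       _    _    = con 0ℚ
multinomialTerm F (c ∷ rs) r    m with r ℕₚ.≤? m
... | yes _ = ⌜ r C c ⌝ * (F 0 ^ c * multinomialTerm (F ∘ suc) rs (r ∸ c) (m ∸ r))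
... | no  _ = con 0ℚ

multinomial-step : ∀ F l M r m →
  (∑[ rs ∈ vectors (upTo (suc M)) (suc l) ] multinomialTerm F rs r (r ℕ.+ m)) ≈
  (∑[ c ∈ upTo (suc M) ] (⌜ r C c ⌝ * (F 0 ^ c *
    (∑[ rs ∈ vectors (upTo (suc M)) l ] multinomialTerm (F ∘ suc) rs (r ∸ c) m))))
multinomial-step F l M r m = ≈-trans
  (∑-cartesianProductWith _∷_ (upTo (suc M)) (vectors (upTo (suc M)) l) _)
  (∑-cong (upTo (suc M)) λ c → ≈-trans (∑-cong (vectors (upTo (suc M)) l) (term c))
    (≈-sym (≈-trans (*-congˡ (*-distribˡ-∑ (vectors (upTo (suc M)) l) _ _)) (*-distribˡ-∑ (vectors (upTo (suc M)) l) _ _))))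
  where
  term : ∀ c rs → multinomialTerm F (c ∷ rs) r (r ℕ.+ m) ≈
                  ⌜ r C c ⌝ * (F 0 ^ c * multinomialTerm (F ∘ suc) rs (r ∸ c) m)
  term c rs with r ℕₚ.≤? r ℕ.+ m
  ... | yes _ = reflexive (cong (λ k → ⌜ r C c ⌝ * (F 0 ^ c * multinomialTerm (F ∘ suc) rs (r ∸ c) k)) (ℕₚ.m+n∸m≡n r m))
  ... | no r≰ = contradiction (ℕₚ.m≤m+n r m) r≰

∑-C-extend : ∀ r M (f : ℕ → Poly) → r ℕ.≤ M →
  (∑[ c ∈ upTo (suc M) ] (⌜ r C c ⌝ * f c)) ≈ (∑[ c ∈ upTo (suc r) ] (⌜ r C c ⌝ * f c))
∑-C-extend r M f r≤M = subst (λ n → ∑ (upTo (suc n)) g ≈ ∑ (upTo (suc r)) g) (ℕₚ.m+[n∸m]≡n r≤M)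
  (∑-upTo-extend (suc r) (M ∸ r) (λ c r<c → ≈-trans (*-congʳ (≈-trans (reflexive (cong ⌜_⌝ (k>n⇒nCk≡0 r<c))) ⌜0⌝)) (zeroˡ _)))
  where
  g : ℕ → Poly
  g c = ⌜ r C c ⌝ * f c

multinomial-zero : ∀ F l M m → (∑[ rs ∈ vectors (upTo (suc M)) l ] multinomialTerm F rs 0 m) ≈ 1ˢ m
multinomial-zero F zero    M zero    = +-identityʳ _
multinomial-zero F zero    M (suc m) = +-identityʳ _
multinomial-zero F (suc l) M m       = begin
  (∑[ rs ∈ vectors (upTo (suc M)) (suc l) ] multinomialTerm F rs 0 m)
    ≈⟨ multinomial-step F l M 0 m ⟩
  (∑[ c ∈ upTo (suc M) ] (⌜ 0 C c ⌝ * (F 0 ^ c * (∑[ rs ∈ vectors (upTo (suc M)) l ] multinomialTerm (F ∘ suc) rs (0 ∸ c) m))))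
    ≈⟨ ∑-C-extend 0 M _ z≤n ⟩
  ⌜ 1 ⌝ * (con 1ℚ * (∑[ rs ∈ vectors (upTo (suc M)) l ] multinomialTerm (F ∘ suc) rs 0 m)) + con 0ℚ
    ≈⟨ ≈-trans (+-identityʳ _) (≈-trans (*-congʳ ⌜1⌝) (≈-trans (*-identityˡ _) (*-identityˡ _))) ⟩
  (∑[ rs ∈ vectors (upTo (suc M)) l ] multinomialTerm (F ∘ suc) rs 0 m)
    ≈⟨ multinomial-zero (F ∘ suc) l M m ⟩
  1ˢ m ∎

-- Induction on `l` by the recurrence for powers of x· F. For 0 < r ≤ m the exponent falls to m - r
-- < m, so the bound by `l` survives the loss of one entry. For r = 0 it does not fall, hence the
-- separate `multinomial-zero`. The bound r ≤ M ensures that entries up to `M` cover every `c` with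
-- a nonzero binomial.
multinomial : ∀ F l M r m → m ℕ.≤ l → r ℕ.≤ M →
  (∑[ rs ∈ vectors (upTo (suc M)) l ] multinomialTerm F rs r m) ≈ ((x· F) ^ˢ r) m
multinomial F l       M zero      m m≤l r≤M = multinomial-zero F l M m
multinomial F zero    M (suc r)   zero m≤l r≤M = ≈-trans (+-identityʳ _) (≈-sym (x·-^-< F (suc r) 0 z<s))
multinomial F (suc l) M r@(suc _) m m≤l r≤M with r ℕₚ.≤? m
... | no r≰m = ≈-trans (∑-cong (vectors (upTo (suc M)) (suc l)) zeros) (≈-trans (∑-zero (vectors (upTo (suc M)) (suc l)) (λ _ → ≈-refl)) (≈-sym (x·-^-< F r m (ℕₚ.≰⇒> r≰m))))
  where
  zeros : ∀ rs → multinomialTerm F rs r m ≈ con 0ℚ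
  zeros (c ∷ rs) with r ℕₚ.≤? m
  ... | yes r≤m = contradiction r≤m r≰m
  ... | no  _   = ≈-refl
... | yes r≤m = subst (λ m → (∑[ rs ∈ vectors (upTo (suc M)) (suc l) ] multinomialTerm F rs r m) ≈ ((x· F) ^ˢ r) m)
  (ℕₚ.m+[n∸m]≡n r≤m) (begin
    (∑[ rs ∈ vectors (upTo (suc M)) (suc l) ] multinomialTerm F rs r (r ℕ.+ k))
      ≈⟨ multinomial-step F l M r k ⟩
    (∑[ c ∈ upTo (suc M) ] (⌜ r C c ⌝ * (F 0 ^ c * (∑[ rs ∈ vectors (upTo (suc M)) l ] multinomialTerm (F ∘ suc) rs (r ∸ c) k))))
      ≈⟨ ∑-cong (upTo (suc M)) (λ c → *-congˡ (*-congˡ (multinomial (F ∘ suc) l M (r ∸ c) k k≤l (ℕₚ.≤-trans (ℕₚ.m∸n≤m r c) r≤M)))) ⟩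
    (∑[ c ∈ upTo (suc M) ] (⌜ r C c ⌝ * (F 0 ^ c * ((x· (F ∘ suc)) ^ˢ (r ∸ c)) k)))
      ≈⟨ ∑-C-extend r M _ r≤M ⟩
    (∑[ c ∈ upTo (suc r) ] (⌜ r C c ⌝ * (F 0 ^ c * ((x· (F ∘ suc)) ^ˢ (r ∸ c)) k)))
      ≈⟨ x·-^-recurrence F r k ⟨
    ((x· F) ^ˢ r) (r ℕ.+ k) ∎)
  where
  k = m ∸ r
  k≤l : k ℕ.≤ l
  k≤l = ℕ.s≤s⁻¹ (ℕₚ.<-≤-trans (ℕₚ.∸-monoʳ-< {m} z<s r≤m) m≤l)

-- Comparison of multinomial terms with Bell summands

map-allFin-suc : ∀ {A : Set} {l} (f : Fin (suc l) → A) → map f (allFin (suc l)) ≡ f fzero ∷ map (f ∘ fsuc) (allFin l)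
map-allFin-suc f = cong (f fzero ∷_) (trans (map-tabulate fsuc f) (sym (map-tabulate id (f ∘ fsuc))))

∏-map : ∀ {A B : Set} (g : A → B) xs (f : B → Poly) → ∏ (map g xs) f ≡ ∏ xs (f ∘ g)
∏-map g []       f = refl
∏-map g (x ∷ xs) f = cong (λ p → f (g x) * p) (∏-map g xs f)

∏-allFin-suc : ∀ {l} (f : Fin (suc l) → Poly) → ∏ (allFin (suc l)) f ≡ f fzero * ∏ (allFin l) (f ∘ fsuc)
∏-allFin-suc {l} f = cong (λ p → f fzero * p)
  (trans (cong (λ xs → ∏ xs f) (sym (map-tabulate id fsuc))) (∏-map fsuc (allFin l) f))

sum-map-suc* : ∀ {A : Set} (f g : A → ℕ) xs →
  sum (map (λ x → suc (f x) ℕ.* g x) xs) ≡ sum (map g xs) ℕ.+ sum (map (λ x → f x ℕ.* g x) xs)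
sum-map-suc* f g []       = refl
sum-map-suc* f g (x ∷ xs) = trans (cong (suc (f x) ℕ.* g x ℕ.+_) (sum-map-suc* f g xs))
  (solveℕ 4 (λ a b c e → (a ⊕ b) ⊕ (c ⊕ e) ⊜ (a ⊕ c) ⊕ (b ⊕ e)) refl (g x) (f x ℕ.* g x) _ _)

sum-lookup : ∀ {l} (rs : Vec ℕ l) → sum (map (lookup rs) (allFin l)) ≡ Vec.sum rs
sum-lookup []       = refl
sum-lookup (c ∷ rs) = trans (cong sum (map-allFin-suc (lookup (c ∷ rs)))) (cong (c ℕ.+_) (sum-lookup rs))

-- Placing `c` in front moves each entry of `rs` one position up and so adds it once more. This is
-- the counterpart of the passage from `m` to `m ∸ r` in `multinomialTerm`.
weightedSum-∷ : ∀ {l} c (rs : Vec ℕ l) → weightedSum (c ∷ rs) ≡ c ℕ.+ Vec.sum rs ℕ.+ weightedSum rs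
weightedSum-∷ {l} c rs = trans (cong sum (map-allFin-suc (λ i → suc (toℕ i) ℕ.* lookup (c ∷ rs) i)))
  (trans (cong₂ ℕ._+_ (ℕₚ.*-identityˡ c)
    (trans (sum-map-suc* (suc ∘ toℕ) (lookup rs) (allFin l)) (cong (ℕ._+ weightedSum rs) (sum-lookup rs))))
  (sym (ℕₚ.+-assoc c _ _)))

factorials-∷ : ∀ {l} c (rs : Vec ℕ l) → factorials (c ∷ rs) ≡ c ! ℕ.* factorials rs
factorials-∷ c rs = cong product (map-allFin-suc (λ i → lookup (c ∷ rs) i !))

monomial : ∀ {l} → Series → Vec ℕ l → Poly
monomial {l} F rs = ∏[ i ∈ allFin l ] (F (toℕ i) ^ lookup rs i)

-- The binomials C(c + s, c) telescope to the multinomial coefficient, because multiplication by c!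
-- s! turns each of them into (c + s)!.
multinomialTerm-value : ∀ {l} F (rs : Vec ℕ l) →
  ⌜ factorials rs ⌝ * multinomialTerm F rs (Vec.sum rs) (weightedSum rs) ≈ ⌜ Vec.sum rs ! ⌝ * monomial F rs
multinomialTerm-value F []       = ≈-refl
multinomialTerm-value {suc l} F (c ∷ rs) = begin
  ⌜ factorials (c ∷ rs) ⌝ * multinomialTerm F (c ∷ rs) (c ℕ.+ s) (weightedSum (c ∷ rs))
    ≡⟨ cong₂ (λ x y → ⌜ x ⌝ * multinomialTerm F (c ∷ rs) (c ℕ.+ s) y) (factorials-∷ c rs) (weightedSum-∷ c rs) ⟩
  ⌜ c ! ℕ.* factorials rs ⌝ * multinomialTerm F (c ∷ rs) (c ℕ.+ s) (c ℕ.+ s ℕ.+ w)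
    ≈⟨ *-cong (⌜⌝-* (c !) _) unfold ⟩
  ⌜ c ! ⌝ * ⌜ factorials rs ⌝ * (⌜ (c ℕ.+ s) C c ⌝ * (F 0 ^ c * multinomialTerm (F ∘ suc) rs s w))
    ≈⟨ solve 5 (λ a b x y z → a :* b :* (x :* (y :* z)) := x :* a :* y :* (b :* z)) ≈-refl _ _ _ _ _ ⟩
  ⌜ (c ℕ.+ s) C c ⌝ * ⌜ c ! ⌝ * F 0 ^ c * (⌜ factorials rs ⌝ * multinomialTerm (F ∘ suc) rs s w)
    ≈⟨ *-congˡ (multinomialTerm-value (F ∘ suc) rs) ⟩
  ⌜ (c ℕ.+ s) C c ⌝ * ⌜ c ! ⌝ * F 0 ^ c * (⌜ s ! ⌝ * monomial (F ∘ suc) rs)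
    ≈⟨ solve 5 (λ a b x y z → a :* b :* x :* (y :* z) := a :* (b :* y) :* (x :* z)) ≈-refl _ _ _ _ _ ⟩
  ⌜ (c ℕ.+ s) C c ⌝ * (⌜ c ! ⌝ * ⌜ s ! ⌝) * (F 0 ^ c * monomial (F ∘ suc) rs)
    ≈⟨ *-cong (≈-trans (⌜⌝-* ((c ℕ.+ s) C c) _) (*-congˡ (⌜⌝-* (c !) (s !)))) (reflexive (∏-allFin-suc {l} _)) ⟨
  ⌜ ((c ℕ.+ s) C c) ℕ.* (c ! ℕ.* s !) ⌝ * monomial F (c ∷ rs)
    ≡⟨ cong (λ n → ⌜ n ⌝ * monomial F (c ∷ rs)) (nCk*[k!*l!]≡n! c s) ⟩
  ⌜ (c ℕ.+ s) ! ⌝ * monomial F (c ∷ rs) ∎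
  where
  s = Vec.sum rs
  w = weightedSum rs
  unfold : multinomialTerm F (c ∷ rs) (c ℕ.+ s) (c ℕ.+ s ℕ.+ w) ≈
           ⌜ (c ℕ.+ s) C c ⌝ * (F 0 ^ c * multinomialTerm (F ∘ suc) rs s w)
  unfold with c ℕ.+ s ℕₚ.≤? c ℕ.+ s ℕ.+ w
  ... | no ≰  = contradiction (ℕₚ.m≤m+n (c ℕ.+ s) w) ≰
  ... | yes _ = reflexive (cong₂ (λ x y → ⌜ (c ℕ.+ s) C c ⌝ * (F 0 ^ c * multinomialTerm (F ∘ suc) rs x y))
    (ℕₚ.m+n∸m≡n c s) (ℕₚ.m+n∸m≡n (c ℕ.+ s) w))

multinomialTerm-vanishes : ∀ {l} F (rs : Vec ℕ l) r m → ¬ (Vec.sum rs ≡ r × weightedSum rs ≡ m) →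
  multinomialTerm F rs r m ≈ con 0ℚ
multinomialTerm-vanishes F []       zero    zero    ¬i = contradiction (refl , refl) ¬i
multinomialTerm-vanishes F []       zero    (suc m) ¬i = ≈-refl
multinomialTerm-vanishes F []       (suc r) m       ¬i = ≈-refl
multinomialTerm-vanishes F (c ∷ rs) r       m       ¬i with r ℕₚ.≤? m | c ℕₚ.≤? r
... | no _    | _      = ≈-refl
-- Here `r ∸ c` truncates, but the binomial is already 0.
... | yes _   | no c≰r = ≈-trans (*-congʳ (≈-trans (reflexive (cong ⌜_⌝ (k>n⇒nCk≡0 (ℕₚ.≰⇒> c≰r)))) ⌜0⌝)) (zeroˡ _)
... | yes r≤m | yes c≤r = ≈-trans (*-congˡ (≈-trans (*-congˡ (multinomialTerm-vanishes (F ∘ suc) rs (r ∸ c) (m ∸ r) ¬i′)) (zeroʳ _))) (zeroʳ _)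
  where
  ¬i′ : ¬ (Vec.sum rs ≡ r ∸ c × weightedSum rs ≡ m ∸ r)
  ¬i′ (s≡ , w≡) = ¬i (sum≡ , trans (weightedSum-∷ c rs) (trans (cong₂ ℕ._+_ sum≡ w≡) (ℕₚ.m+[n∸m]≡n r≤m)))
    where
    sum≡ : c ℕ.+ Vec.sum rs ≡ r
    sum≡ = trans (cong (c ℕ.+_) s≡) (ℕₚ.m+[n∸m]≡n c≤r)

-- The series x· (egf f ∘ suc) is `egf f` without its constant term 1. The m! in the Bell
-- coefficient cancels against `1/ m !`, which leaves the multinomial coefficient.
B-coefficient : ∀ f m r → r ℕ.≤ m →
  con ((+ (r !) ℚ./ 1) ℚ.* (1/ m !)) * B m r f ≈ ((x· (egf f ∘ suc)) ^ˢ r) m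
B-coefficient f m r r≤m = begin
  con ((+ (r !) ℚ./ 1) ℚ.* (1/ m !)) * B m r f
    ≈⟨ *-distribˡ-∑ (bellIndices m r) _ _ ⟩
  (∑[ rs ∈ bellIndices m r ] (con ((+ (r !) ℚ./ 1) ℚ.* (1/ m !)) * (con (bellCoefficient m rs) * monomial F rs)))
    ≈⟨ ∑-filter (isBellIndex? m r) index (λ rs → multinomialTerm-vanishes F rs r m) (vectors (upTo (suc m)) m) ⟩
  (∑[ rs ∈ vectors (upTo (suc m)) m ] multinomialTerm F rs r m)
    ≈⟨ multinomial F m m r m ℕₚ.≤-refl r≤m ⟩
  ((x· F) ^ˢ r) m ∎
  where
  F = egf f ∘ suc
  index : ∀ rs → IsBellIndex m r rs →
    con ((+ (r !) ℚ./ 1) ℚ.* (1/ m !)) * (con (bellCoefficient m rs) * monomial F rs) ≈ multinomialTerm F rs r m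
  index rs (s≡ , w≡) = ⌜⌝-cancelˡ (factorials rs) {{factorials≢0 rs}} (begin
    ⌜ factorials rs ⌝ * (con ((+ (r !) ℚ./ 1) ℚ.* (1/ m !)) * (con (bellCoefficient m rs) * monomial F rs))
      ≈⟨ *-congˡ (*-cong (≈-trans (con-* _ _) (*-congʳ (con-/1 (r !))))
                         (*-congʳ (≈-trans (con-/ (m !) (factorials rs) {{factorials≢0 rs}}) (*-congʳ (≈-sym (con-/1 (m !))))))) ⟩
    ⌜ factorials rs ⌝ * (⌜ r ! ⌝ * con (1/ m !) * (con (+ (m !) ℚ./ 1) * inv (factorials rs) {{factorials≢0 rs}} * monomial F rs))
      ≈⟨ solve 6 (λ a b x y i z → a :* (b :* x :* (y :* i :* z)) := (x :* y) :* ((a :* i) :* (b :* z))) ≈-refl _ _ _ _ _ _ ⟩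
    con (1/ m !) * con (+ (m !) ℚ./ 1) * (⌜ factorials rs ⌝ * inv (factorials rs) {{factorials≢0 rs}} * (⌜ r ! ⌝ * monomial F rs))
      ≈⟨ *-cong (1/!-! m) (*-congʳ (⌜⌝-inv (factorials rs) {{factorials≢0 rs}})) ⟩
    con 1ℚ * (con 1ℚ * (⌜ r ! ⌝ * monomial F rs))
      ≈⟨ ≈-trans (*-identityˡ _) (*-identityˡ _) ⟩
    ⌜ r ! ⌝ * monomial F rs
      ≡⟨ cong (λ r → ⌜ r ! ⌝ * monomial F rs) s≡ ⟨
    ⌜ Vec.sum rs ! ⌝ * monomial F rs
      ≈⟨ multinomialTerm-value F rs ⟨
    ⌜ factorials rs ⌝ * multinomialTerm F rs (Vec.sum rs) (weightedSum rs)
      ≡⟨ cong₂ (λ r m → ⌜ factorials rs ⌝ * multinomialTerm F rs r m) s≡ w≡ ⟩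
    ⌜ factorials rs ⌝ * multinomialTerm F rs r m ∎)

egf-^-Bell : ∀ f e m → (egf f ^ˢ e) m ≈
  (∑[ r ∈ upTo (suc m) ] (con (+ (e C r) ℚ./ 1) * con ((+ (r !) ℚ./ 1) ℚ.* (1/ m !)) * B m r f))
egf-^-Bell f e m = begin
  (egf f ^ˢ e) m
    ≈⟨ ^ˢ-cong split e m ⟩
  (((x· F) +ˢ 1ˢ) ^ˢ e) m
    ≈⟨ binomialˢ e (x· F) 1ˢ m ⟩
  (∑[ r ∈ upTo (suc e) ] (⌜ e C r ⌝ * (((x· F) ^ˢ r) *ˢ (1ˢ ^ˢ (e ∸ r))) m))
    ≈⟨ ∑-cong (upTo (suc e)) (λ r → *-congˡ (≈-trans (*ˢ-cong {(x· F) ^ˢ r} (λ _ → ≈-refl) (1ˢ-^ (e ∸ r)) m) (*ˢ-identityʳ _ m))) ⟩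
  ∑ (upTo (suc e)) term
    -- The binomial theorem sums up to `e`, the Bell form up to `m`. Both agree with the sum over a
    -- common longer range: terms with r > e vanish through the binomial, terms with r > m because
    -- (x· F)^r starts at x^r.
    ≈⟨ ∑-upTo-extend (suc e) (suc m) (λ r e<r → ≈-trans (*-congʳ (≈-trans (reflexive (cong ⌜_⌝ (k>n⇒nCk≡0 e<r))) ⌜0⌝)) (zeroˡ _)) ⟨
  ∑ (upTo (suc e ℕ.+ suc m)) term
    ≡⟨ cong (λ n → ∑ (upTo n) term) (ℕₚ.+-comm (suc e) (suc m)) ⟩
  ∑ (upTo (suc m ℕ.+ suc e)) term
    ≈⟨ ∑-upTo-extend (suc m) (suc e) (λ r m<r → ≈-trans (*-congˡ (x·-^-< F r m m<r)) (zeroʳ _)) ⟩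
  ∑ (upTo (suc m)) term
    ≈⟨ ∑-upTo-cong (suc m) (λ { r (s≤s r≤m) → ≈-trans (*-assoc _ _ _) (*-cong (con-/1 (e C r)) (B-coefficient f m r r≤m)) }) ⟨
  (∑[ r ∈ upTo (suc m) ] (con (+ (e C r) ℚ./ 1) * con ((+ (r !) ℚ./ 1) ℚ.* (1/ m !)) * B m r f)) ∎
  where
  F = egf f ∘ suc
  term : ℕ → Poly
  term r = ⌜ e C r ⌝ * ((x· F) ^ˢ r) m
  split : egf f ≈ˢ (x· F) +ˢ 1ˢ
  split zero    = ≈-sym (+-identityˡ _)
  split (suc n) = ≈-sym (+-identityʳ _)

theorem4p2 : ∀ (k j m : ℕ) .{{_ : NonZero m}} →
  let n = 2 ℕ.* m ℕ.+ k ℕ.* j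
      c = con (+ m / ((m ℕ.+ j ℕ.+ 1) ℕ.* (m ℕ.+ j))) * con (+ ((m ℕ.+ j) C j) / 1)
      LHS = ∑[ Q ∈ 𝔔 k n m j ] weight Q
      potentialForm = c * (con (1/ m !) * potential (m ℕ.+ j ℕ.+ 1) m i!t)
      bellForm = c * (∑[ r ∈ upTo (suc m) ] (con (+ ((m ℕ.+ j ℕ.+ 1) C r) / 1) * con ((+ (r !) / 1) ℚ.* (1/ m !)) * B m r i!t))
  in (LHS ≈ potentialForm) × (potentialForm ≈ bellForm)
theorem4p2 k j m =
    ≈-trans (∑-𝔔 k j m) (≈-trans (total-closed (egf i!t) m j) (*-congˡ (≈-sym coefficient)))
  , *-congˡ (≈-trans coefficient (egf-^-Bell i!t (m ℕ.+ j ℕ.+ 1) m))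
  where
  coefficient : con (1/ m !) * potential (m ℕ.+ j ℕ.+ 1) m i!t ≈ (egf i!t ^ˢ (m ℕ.+ j ℕ.+ 1)) m
  coefficient = ≈-trans (≈-sym (*-assoc _ _ _)) (≈-trans (*-congʳ (1/!-! m)) (*-identityˡ _))
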